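{- For all $k\geq1$, $\epsilon>0$ and non-increasing $f:\mathbb{N}\to(0,1]$, there is $M=M(k,\epsilon,f)$ such that the following holds. Suppose $G=(V,E)$ is a finite $k$-stable graph. Then there are $m\leq M$ and a partition $V=W_0\cup W_1\cup\dots\cup W_m$ such that $|W_0|\leq\epsilon|V|$, and such that for all $1\leq i,j\leq m$, $(W_i,W_j)$ satisfies $\mathrm{disc}_2(f(m))$ and $|W_i|=|W_j|$.
   Context: A graph $G=(V,E)$ has the $k$-order property if there are $a_1,\dots,a_k,b_1,\dots,b_k\in V$ such that $a_ib_j\in E$ if and only if $i\leq j$; otherwise $G$ is $k$-stable. For $X,Y\subseteq V$ let $e(X,Y)$ be the number of ordered pairs $(x,y)\in X\times Y$ with $xy\in E$, and let $d=e(X,Y)/(|X||Y|)$. The pair $(X,Y)$ satisfies $\mathrm{disc}_2(\epsilon')$ if for all $X'\subseteq X$ and $Y'\subseteq Y$, $|e(X',Y')-d|X'||Y'||\leq\epsilon'|X||Y|$. -}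

module Defs where

open import Level using (0ℓ)
open import Data.Nat.Base as ℕ using (ℕ; zero; suc)
open import Data.Integer.Base using (+_)
open import Data.Rational.Base as ℚ
  using (ℚ; 0ℚ; 1ℚ; _+_; _*_; _-_; -_; ∣_∣; 1/_; _/_; Positive; NonZero)
import Data.Rational.Properties as ℚₚ
open import Data.Fin.Base as Fin using (Fin)
open import Data.Fin.Subset as Subset using (Subset; _∈_; _⊆_; Nonempty)
open import Data.Fin.Subset.Properties using (_∈?_)
open import Data.List.Base using (length; filter; cartesianProduct; allFin)
open import Data.Product using (∃; ∃!; _×_; _,_; proj₁; proj₂)
open import Function.Bundles using (_⇔_)
open import Relation.Binary.Core using (Rel)
open import Relation.Binary.Definitions using (Symmetric; Irreflexive; Decidable)
open import Relation.Binary.PropositionalEquality using (_≡_; sym; trans; cong; subst)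
open import Relation.Nullary.Negation using (¬_)
open import Relation.Nullary.Decidable using (_×-dec_)

------------------------------------------------------------------------
-- Real numbers, as rational Cauchy sequences.  The standard library has
-- no reals; only the order and multiplication by rationals are needed.

IsCauchy : (ℕ → ℚ) → Set
IsCauchy s = ∀ δ → 0ℚ ℚ.< δ →
  ∃ λ N → ∀ m n → N ℕ.≤ m → N ℕ.≤ n → ∣ s m - s n ∣ ℚ.≤ δ

record ℝ : Set where
  constructor mkℝ
  field
    seq    : ℕ → ℚ
    cauchy : IsCauchy seq

open ℝ public

infix 4 _≤ℝ_ _<ℝ_

-- Neither relation is the termwise one: _≤ℝ_ asks for termwise ≤
-- eventually, up to every positive slack, and _<ℝ_ asks for a positive
-- rational gap that holds eventually.

_≤ℝ_ : Rel ℝ 0ℓ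
x ≤ℝ y = ∀ δ → 0ℚ ℚ.< δ → ∃ λ N → ∀ n → N ℕ.≤ n → seq x n ℚ.≤ seq y n + δ

_<ℝ_ : Rel ℝ 0ℓ
x <ℝ y = ∃ λ δ → 0ℚ ℚ.< δ × ∃ λ N → ∀ n → N ℕ.≤ n → seq x n + δ ℚ.≤ seq y n

fromℚ : ℚ → ℝ
fromℚ q = mkℝ (λ _ → q) λ δ 0<δ → 0 , λ _ _ _ _ →
  subst (ℚ._≤ δ) (cong ∣_∣ (sym (ℚₚ.+-inverseʳ q))) (ℚₚ.<⇒≤ 0<δ)

0ℝ 1ℝ : ℝ
0ℝ = fromℚ 0ℚ
1ℝ = fromℚ 1ℚ

infixr 7 _·_

_·_ : ℚ → ℝ → ℝ
q · x = mkℝ (λ n → q * seq x n) λ δ 0<δ →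
  let N , close = cauchy x (δ * 1/ r) (0<δ/r δ 0<δ)
  in  N , λ m n N≤m N≤n → bound δ (seq x m) (seq x n) (close m n N≤m N≤n)
  where
  open ℚₚ.≤-Reasoning

  r : ℚ
  r = ∣ q ∣ + 1ℚ

  instance
    r-pos : Positive r
    r-pos = ℚₚ.nonNeg+pos⇒pos ∣ q ∣ {{ℚ.nonNegative (ℚₚ.0≤∣p∣ q)}} 1ℚ

    r-nonNeg : ℚ.NonNegative r
    r-nonNeg = ℚₚ.pos⇒nonNeg r

    r≢0 : NonZero r
    r≢0 = ℚₚ.pos⇒nonZero r

  0<δ/r : ∀ δ → 0ℚ ℚ.< δ → 0ℚ ℚ.< δ * 1/ r
  0<δ/r δ 0<δ = ℚₚ.positive⁻¹ _
    {{ℚₚ.pos*pos⇒pos δ {{ℚ.positive 0<δ}} (1/ r) {{ℚₚ.1/pos⇒pos r}}}}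

  ∣q∣≤r : ∣ q ∣ ℚ.≤ r
  ∣q∣≤r = subst (ℚ._≤ r) (ℚₚ.+-identityʳ ∣ q ∣) (ℚₚ.+-monoʳ-≤ ∣ q ∣ (ℚₚ.<⇒≤ (ℚₚ.positive⁻¹ 1ℚ)))

  bound : ∀ δ a b → ∣ a - b ∣ ℚ.≤ δ * 1/ r → ∣ q * a - q * b ∣ ℚ.≤ δ
  bound δ a b h = begin
    ∣ q * a - q * b ∣      ≡⟨ cong (λ z → ∣ q * a + z ∣) (ℚₚ.neg-distribʳ-* q b) ⟩
    ∣ q * a + q * - b ∣    ≡⟨ cong ∣_∣ (sym (ℚₚ.*-distribˡ-+ q a (- b))) ⟩
    ∣ q * (a - b) ∣        ≡⟨ ℚₚ.∣p*q∣≡∣p∣*∣q∣ q (a - b) ⟩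
    ∣ q ∣ * ∣ a - b ∣      ≤⟨ ℚₚ.*-monoʳ-≤-nonNeg ∣ a - b ∣
                                {{ℚ.nonNegative (ℚₚ.0≤∣p∣ (a - b))}} ∣q∣≤r ⟩
    r * ∣ a - b ∣          ≤⟨ ℚₚ.*-monoˡ-≤-nonNeg r h ⟩
    r * (δ * 1/ r)         ≡⟨ cong (r *_) (ℚₚ.*-comm δ (1/ r)) ⟩
    r * (1/ r * δ)         ≡⟨ sym (ℚₚ.*-assoc r (1/ r) δ) ⟩
    r * 1/ r * δ           ≡⟨ cong (_* δ) (ℚₚ.*-inverseʳ r) ⟩
    1ℚ * δ                 ≡⟨ ℚₚ.*-identityˡ δ ⟩
    δ                      ∎

fromℕ : ℕ → ℚ
fromℕ n = + n / 1

-- Total division, with a / 0 = 0.  The density of a pair of nonempty sets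
-- never has denominator 0.
ratio : ℕ → ℕ → ℚ
ratio a zero    = 0ℚ
ratio a (suc b) = + a / suc b

------------------------------------------------------------------------
-- Finite graphs

record Graph (n : ℕ) : Set₁ where
  field
    Adj    : Rel (Fin n) 0ℓ
    adj?   : Decidable Adj
    symm   : Symmetric Adj
    irrefl : Irreflexive _≡_ Adj

module _ {n : ℕ} (G : Graph n) where
  open Graph G

  -- The vertices need not be distinct, and some a i may equal some b j.
  OrderProperty : ℕ → Set
  OrderProperty k = ∃ λ (a : Fin k → Fin n) → ∃ λ (b : Fin k → Fin n) →
    ∀ i j → Adj (a i) (b j) ⇔ i Fin.≤ j

  Stable : ℕ → Set
  Stable k = ¬ OrderProperty k

  e : Subset n → Subset n → ℕ
  e X Y = length (filter
    (λ p → proj₁ p ∈? X ×-dec proj₂ p ∈? Y ×-dec adj? (proj₁ p) (proj₂ p))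
    (cartesianProduct (allFin n) (allFin n)))

  density : Subset n → Subset n → ℚ
  density X Y = ratio (e X Y) (Subset.∣ X ∣ ℕ.* Subset.∣ Y ∣)

  Disc₂ : ℝ → Subset n → Subset n → Set
  Disc₂ ε X Y = ∀ (X′ Y′ : Subset n) → X′ ⊆ X → Y′ ⊆ Y →
    fromℚ ∣ fromℕ (e X′ Y′) - density X Y * fromℕ (Subset.∣ X′ ∣ ℕ.* Subset.∣ Y′ ∣) ∣
      ≤ℝ fromℕ (Subset.∣ X ∣ ℕ.* Subset.∣ Y ∣) · ε

-- A partition W₀ ∪ W₁ ∪ … ∪ Wₘ with exceptional class W₀, the only class
-- that may be empty.
record IsPartition {n m : ℕ} (W : Fin (suc m) → Subset n) : Set where
  field
    cover-disjoint : ∀ v → ∃! _≡_ λ i → v ∈ W i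
    nonempty       : ∀ (i : Fin m) → Nonempty (W (Fin.suc i))

module Submission where

open import Defs
open import Data.Nat.Base using (ℕ; suc; _≤_)
open import Data.Fin.Base using (Fin; zero; suc)
open import Data.Fin.Subset using (Subset; ∣_∣)
open import Data.Product.Base using (∃; _×_)
open import Relation.Binary.PropositionalEquality using (_≡_)

open import Level using (0ℓ)
open import Data.Bool.Base using (Bool; true; false; if_then_else_; not; _∧_)
open import Data.Bool.Properties using (not-involutive)
open import Data.Empty using (⊥-elim)
open import Data.Fin.Base as Fin using (toℕ; fromℕ<)
open import Data.Fin.Properties using (any?; toℕ<n; toℕ-fromℕ<)
open import Data.Fin.Subset using (_∩_; ∁; _∈_; _⊆_; Nonempty; ⊤; ⊥)
open import Data.Fin.Subset.Properties
  using (_∈?_; p∩q⊆p; x∈p∩q⁻; x∈p∩q⁺; p⊆q⇒∣p∣≤∣q∣; nonempty?; x∈∁p⇒x∉p; ∣p∩q∣≤∣p∣; ∣p∣≤n; ∣⊥∣≡0; ∣⊤∣≡n;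
         Empty-unique; x∈p⇒∣p-x∣<∣p∣)
open import Data.List.Base as List using (List; []; _∷_; _++_; length; filter; cartesianProduct)
open import Data.List.Properties using (length-++; filter-++; map-++; ++-identityʳ)
open import Data.List.Membership.Propositional.Properties using (∈-lookup)
open import Data.List.Relation.Unary.All as All using (All; []; _∷_)
import Data.List.Relation.Unary.All.Properties as All
open import Data.List.Relation.Unary.AllPairs using (AllPairs; []; _∷_)
import Data.List.Relation.Unary.AllPairs.Properties as AllPairs
open import Data.Nat.Base hiding (ℕ; suc; _≤_)
open import Data.Nat.DivMod using (m≡m%n+[m/n]*n; m%n<n; m/n*n≤m)
open import Data.Nat.ListAction using () renaming (sum to sumᴸ)
open import Data.Nat.ListAction.Properties using () renaming (sum-++ to sumᴸ-++)
open import Data.Nat.Properties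
open import Data.Nat.Tactic.RingSolver using (solve-∀)
open import Data.Product using (∃!)
open import Data.Product.Base using (∃-syntax; _,_; proj₁; proj₂)
open import Data.Sum.Base using (_⊎_; inj₁; inj₂; swap) renaming (map to map-⊎)
import Data.Unit.Base as Unit
open import Data.Vec.Base using ([]; _∷_; lookup; tabulate)
open import Data.Vec.Properties
  using (lookup∘tabulate; lookup-zipWith; lookup-map; lookup-replicate; []=⇒lookup; lookup⇒[]=)
open import Function.Base using (_∘_; flip; id)
open import Function.Bundles using (mk⇔)
open import Relation.Binary.PropositionalEquality hiding (_≡_)
open import Relation.Nullary using (Dec; yes; no; does; ¬_)
open import Relation.Nullary.Decidable using (_×-dec_; dec-true; does-⇔)
open import Relation.Unary using (Pred; Decidable)
open import Data.Integer.Base as ℤ using (+[1+_])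
import Data.Integer.Properties as ℤₚ
import Data.Integer.Tactic.RingSolver as ℤ-Ring
open import Data.Rational.Base as ℚ using (mkℚ; 0ℚ; 1ℚ; toℚᵘ)
import Data.Rational.Properties as ℚₚ
open import Data.Rational.Solver using (module +-*-Solver)
open import Data.Rational.Unnormalised.Base as ℚᵘ using (mkℚᵘ; *≡*)
import Data.Rational.Unnormalised.Properties as ℚᵘₚ
open import Algebra.Properties.Group ℚₚ.+-0-group using (⁻¹-involutive)
import Algebra.Properties.Semiring.Sum +-*-semiring as Sum

-- Let n be the number of vertices and call a set A t-good if every vertex v has |A ∩ N v| ≤ n / t or
-- |A ∖ N v| ≤ n / t. If X and Y have equal sizes comparable to n and are both t-good with t large, then the
-- adjacency matrix of X × Y has nearly constant rows and nearly constant columns, so its density is close to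
-- 0 or 1, which is more than disc₂ asks for. It therefore suffices to cover almost all vertices by boundedly
-- many, say r, good sets, with a goodness that is an arbitrary prescribed function of r, and to cut these
-- into small parts of equal size.
--
-- By stability, the full binary trees obtained by splitting V repeatedly along neighbourhoods have bounded
-- height. Induct on this rank. A set that is not t-good is split by some vertex into two large parts, one of
-- which has smaller rank; put that part aside and continue with the other one, the core, which is t-good
-- after at most t steps. The parts put aside are covered by induction, say by r good sets, and only then is
-- the new goodness t that the core needs known. Refining the core for this t may put aside further sets, but
-- the size of the core can drop substantially only boundedly often; when it does not drop, the difference is
-- discarded into the exceptional set.

-- Indicators and sums over finite sets

𝟙 : Bool → ℕ
𝟙 b = if b then 1 else 0

𝟙-∧ : ∀ a b → 𝟙 (a ∧ b) ≡ 𝟙 a * 𝟙 b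
𝟙-∧ true  b = sym (+-identityʳ (𝟙 b))
𝟙-∧ false b = refl

𝟙-split : ∀ a b → 𝟙 (a ∧ b) + 𝟙 (a ∧ not b) ≡ 𝟙 a
𝟙-split false _     = refl
𝟙-split true  false = refl
𝟙-split true  true  = refl

-- Opaque, since unification would otherwise unfold the sum and lose its length.
opaque
  sum : ∀ {n} → (Fin n → ℕ) → ℕ
  sum = Sum.sum

  sum-zero : ∀ (f : Fin 0 → ℕ) → sum f ≡ 0
  sum-zero f = refl

  sum-suc : ∀ {n} (f : Fin (suc n) → ℕ) → sum f ≡ f zero + sum (f ∘ suc)
  sum-suc f = refl

  sum-cong : ∀ {n} {f g : Fin n → ℕ} → (∀ x → f x ≡ g x) → sum f ≡ sum g
  sum-cong = Sum.sum-cong-≗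

  sum-0 : ∀ n → sum {n} (λ _ → 0) ≡ 0
  sum-0 = Sum.sum-replicate-zero

  sum-+ : ∀ {n} (f g : Fin n → ℕ) → sum (λ x → f x + g x) ≡ sum f + sum g
  sum-+ = Sum.∑-distrib-+

  sum-*ˡ : ∀ {n} c (f : Fin n → ℕ) → c * sum f ≡ sum (λ x → c * f x)
  sum-*ˡ = Sum.*-distribˡ-sum

  sum-*ʳ : ∀ {n} c (f : Fin n → ℕ) → sum f * c ≡ sum (λ x → f x * c)
  sum-*ʳ = Sum.*-distribʳ-sum

  sum-comm : ∀ {m n} (f : Fin m → Fin n → ℕ) → sum (λ x → sum (f x)) ≡ sum (λ y → sum (flip f y))
  sum-comm = Sum.∑-comm

  sum-mono : ∀ {n} {f g : Fin n → ℕ} → (∀ x → f x ≤ g x) → sum f ≤ sum g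
  sum-mono {zero}  f≤g = z≤n
  sum-mono {suc n} f≤g = +-mono-≤ (f≤g zero) (sum-mono (f≤g ∘ suc))

  ∣∣-sum : ∀ {n} (A : Subset n) → ∣ A ∣ ≡ sum (λ x → 𝟙 (lookup A x))
  ∣∣-sum []          = refl
  ∣∣-sum (true  ∷ A) = cong suc (∣∣-sum A)
  ∣∣-sum (false ∷ A) = ∣∣-sum A

lookup-∩ : ∀ {n} (A B : Subset n) x → lookup (A ∩ B) x ≡ lookup A x ∧ lookup B x
lookup-∩ A B x = lookup-zipWith _∧_ x A B

lookup-∩∁ : ∀ {n} (A B : Subset n) x → lookup (A ∩ ∁ B) x ≡ lookup A x ∧ not (lookup B x)
lookup-∩∁ A B x = trans (lookup-∩ A (∁ B) x) (cong (lookup A x ∧_) (lookup-map x not B))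

lookup-split : ∀ {n} (A B : Subset n) x →
               𝟙 (lookup (A ∩ B) x) + 𝟙 (lookup (A ∩ ∁ B) x) ≡ 𝟙 (lookup A x)
lookup-split A B x rewrite lookup-∩ A B x | lookup-∩∁ A B x = 𝟙-split (lookup A x) (lookup B x)

∣∣-split : ∀ {n} (A B : Subset n) → ∣ A ∩ B ∣ + ∣ A ∩ ∁ B ∣ ≡ ∣ A ∣
∣∣-split A B rewrite ∣∣-sum (A ∩ B) | ∣∣-sum (A ∩ ∁ B) | ∣∣-sum A =
  trans (sym (sum-+ _ _)) (sum-cong (lookup-split A B))

⊆⇒𝟙≤ : ∀ {n} {A B : Subset n} → A ⊆ B → ∀ x → 𝟙 (lookup A x) ≤ 𝟙 (lookup B x)
⊆⇒𝟙≤ {A = A} A⊆B x with lookup A x in eq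
... | false = z≤n
... | true  = ≤-reflexive (sym (cong 𝟙 ([]=⇒lookup (A⊆B (lookup⇒[]= x A eq)))))

-- Counting related pairs

row : ∀ {n} → (Fin n → Fin n → Bool) → Fin n → Subset n → ℕ
row R x Y = sum λ y → 𝟙 (lookup Y y) * 𝟙 (R x y)

count : ∀ {n} → (Fin n → Fin n → Bool) → Subset n → Subset n → ℕ
count R X Y = sum λ x → 𝟙 (lookup X x) * row R x Y

complement : ∀ {n} → (Fin n → Fin n → Bool) → Fin n → Fin n → Bool
complement R x y = not (R x y)

-- Double complements arise when a statement is applied to `complement R`; they do not reduce,
-- because `not (not b)` is stuck for a variable `b`.
row-complement² : ∀ {n} (R : Fin n → Fin n → Bool) x Y → row (complement (complement R)) x Y ≡ row R x Y
row-complement² R x Y = sum-cong λ y → cong (λ b → 𝟙 (lookup Y y) * 𝟙 b) (not-involutive (R x y))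

count-complement² : ∀ {n} (R : Fin n → Fin n → Bool) X Y → count (complement (complement R)) X Y ≡ count R X Y
count-complement² R X Y = sum-cong λ x → cong (𝟙 (lookup X x) *_) (row-complement² R x Y)

module _ {n : ℕ} (R : Fin n → Fin n → Bool) where

  row-mono : ∀ x {Y Y′} → Y ⊆ Y′ → row R x Y ≤ row R x Y′
  row-mono x Y⊆Y′ = sum-mono λ y → *-monoˡ-≤ _ (⊆⇒𝟙≤ Y⊆Y′ y)

  row-split : ∀ x Y Z → row R x (Y ∩ Z) + row R x (Y ∩ ∁ Z) ≡ row R x Y
  row-split x Y Z = trans (sym (sum-+ _ _)) (sum-cong λ y →
    trans (sym (*-distribʳ-+ (𝟙 (R x y)) (𝟙 (lookup (Y ∩ Z) y)) _))
          (cong (_* 𝟙 (R x y)) (lookup-split Y Z y)))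

  row-complement : ∀ x Y → row R x Y + row (complement R) x Y ≡ ∣ Y ∣
  row-complement x Y = trans (sym (sum-+ _ _)) (trans (sum-cong pointwise) (sym (∣∣-sum Y)))
    where
    pointwise : ∀ y → 𝟙 (lookup Y y) * 𝟙 (R x y) + 𝟙 (lookup Y y) * 𝟙 (not (R x y)) ≡ 𝟙 (lookup Y y)
    pointwise y rewrite sym (𝟙-∧ (lookup Y y) (R x y)) | sym (𝟙-∧ (lookup Y y) (not (R x y))) =
      𝟙-split (lookup Y y) (R x y)

  count-mono : ∀ {X X′ Y Y′} → X ⊆ X′ → Y ⊆ Y′ → count R X Y ≤ count R X′ Y′
  count-mono X⊆X′ Y⊆Y′ = sum-mono λ x → *-mono-≤ (⊆⇒𝟙≤ X⊆X′ x) (row-mono x Y⊆Y′)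

  count-splitʳ : ∀ X Y Z → count R X (Y ∩ Z) + count R X (Y ∩ ∁ Z) ≡ count R X Y
  count-splitʳ X Y Z = trans (sym (sum-+ _ _)) (sum-cong λ x →
    trans (sym (*-distribˡ-+ (𝟙 (lookup X x)) (row R x (Y ∩ Z)) _))
          (cong (𝟙 (lookup X x) *_) (row-split x Y Z)))

  count-complement : ∀ X Y → count R X Y + count (complement R) X Y ≡ ∣ X ∣ * ∣ Y ∣
  count-complement X Y = trans (sym (sum-+ _ _)) (trans (sum-cong λ x →
    trans (sym (*-distribˡ-+ (𝟙 (lookup X x)) (row R x Y) _))
          (cong (𝟙 (lookup X x) *_) (row-complement x Y)))
    (trans (sym (sum-*ʳ ∣ Y ∣ (λ x → 𝟙 (lookup X x)))) (cong (_* ∣ Y ∣) (sym (∣∣-sum X)))))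

  count-flip : ∀ X Y → count R X Y ≡ count (flip R) Y X
  count-flip X Y = trans (sum-cong λ x → sum-*ˡ (𝟙 (lookup X x)) _)
    (trans (sum-comm _) (sum-cong λ y → trans
      (sum-cong λ x → exchange (𝟙 (lookup X x)) (𝟙 (lookup Y y)) (𝟙 (R x y)))
      (sym (sum-*ˡ (𝟙 (lookup Y y)) _))))
    where
    exchange : ∀ a b c → a * (b * c) ≡ b * (a * c)
    exchange = solve-∀

  count≤ : ∀ T s X Y → (∀ x → lookup X x ≡ true → T * row R x Y ≤ s) → T * count R X Y ≤ ∣ X ∣ * s
  count≤ T s X Y bound = begin
    T * count R X Y                               ≡⟨ sum-*ˡ T _ ⟩
    sum (λ x → T * (𝟙 (lookup X x) * row R x Y))  ≤⟨ sum-mono pointwise ⟩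
    sum (λ x → 𝟙 (lookup X x) * s)                ≡⟨ sum-*ʳ s _ ⟨
    sum (λ x → 𝟙 (lookup X x)) * s                ≡⟨ cong (_* s) (∣∣-sum X) ⟨
    ∣ X ∣ * s                                     ∎
    where
    open ≤-Reasoning
    pointwise : ∀ x → T * (𝟙 (lookup X x) * row R x Y) ≤ 𝟙 (lookup X x) * s
    pointwise x with lookup X x in eq
    ... | false = ≤-reflexive (*-zeroʳ T)
    ... | true  rewrite +-identityʳ (row R x Y) | +-identityʳ s = bound x eq

-- Matrices with nearly constant rows and columns

∧-true : ∀ a b → a ∧ b ≡ true → a ≡ true × b ≡ true
∧-true true true _ = refl , refl

module _ {n : ℕ} (T s : ℕ) where

  -- The row of `x` is full on `Y` up to few exceptions; nearly empty rows are expressed through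
  -- `complement R`.
  Nearly : (Fin n → Fin n → Bool) → Fin n → Subset n → Set
  Nearly R x Y = T * row (complement R) x Y ≤ s

  where-nearly : (Fin n → Fin n → Bool) → Subset n → Subset n
  where-nearly R Y = tabulate λ x → does (T * row (complement R) x Y ≤? s)

  where-nearly⁻ : ∀ R Y x → lookup (where-nearly R Y) x ≡ true → Nearly R x Y
  where-nearly⁻ R Y x eq with T * row (complement R) x Y ≤? s in eq′ | trans (sym (lookup∘tabulate _ x)) eq
  ... | yes p | _ = p
  ... | no ¬p | eq″ with trans (sym (cong does eq′)) eq″
  ... | ()

  where-nearly-∁ : ∀ R Y x → lookup (where-nearly R Y) x ≡ false → ¬ Nearly R x Y
  where-nearly-∁ R Y x eq p with trans (sym eq) (trans (lookup∘tabulate _ x) (dec-true (_ ≤? _) p))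
  ... | ()

  -- If half of the rows are nearly full, then nearly empty columns are rare, since the submatrix in which
  -- both kinds meet has few ones and few zeros.
  mostly-full : ∀ (R : Fin n → Fin n → Bool) X Y P → ∣ X ∣ ≤ s → ∣ Y ∣ ≤ s → P ⊆ X → s ≤ 2 * ∣ P ∣ →
                (∀ x → lookup P x ≡ true → Nearly R x Y) →
                (∀ y → Nearly (complement (flip R)) y X ⊎ Nearly (flip R) y X) →
                T * count (complement R) X Y ≤ 5 * (s * s)
  mostly-full R X Y P X≤s Y≤s P⊆X s≤2P rows cols = begin
    T * count R̄ X Y                         ≡⟨ cong (T *_) (count-splitʳ R̄ X Y Z) ⟨
    T * (count R̄ X Q + count R̄ X Q′)        ≡⟨ *-distribˡ-+ T (count R̄ X Q) _ ⟩
    T * count R̄ X Q + T * count R̄ X Q′      ≤⟨ +-mono-≤ in-Q in-Q′ ⟩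
    4 * (s * s) + s * s                     ≡⟨ 4+1 (s * s) ⟩
    5 * (s * s)                             ∎
    where
    open ≤-Reasoning
    R̄ = complement R
    Z  = where-nearly (complement (flip R)) X
    Q  = Y ∩ Z
    Q′ = Y ∩ ∁ Z

    4+1 : ∀ a → 4 * a + a ≡ 5 * a
    4+1 = solve-∀

    Q≤s : ∣ Q ∣ ≤ s
    Q≤s = ≤-trans (p⊆q⇒∣p∣≤∣q∣ (p∩q⊆p Y Z)) Y≤s

    Q′≤s : ∣ Q′ ∣ ≤ s
    Q′≤s = ≤-trans (p⊆q⇒∣p∣≤∣q∣ (p∩q⊆p Y (∁ Z))) Y≤s

    col-Q : ∀ y → lookup Q y ≡ true → T * row (flip R) y P ≤ s
    col-Q y y∈Q = ≤-trans
      (*-monoʳ-≤ T (≤-trans (row-mono (flip R) y P⊆X) (≤-reflexive (sym (row-complement² (flip R) y X)))))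
      (where-nearly⁻ (complement (flip R)) X y
        (proj₂ (∧-true (lookup Y y) _ (trans (sym (lookup-∩ Y Z y)) y∈Q))))

    col-Q′ : ∀ y → lookup Q′ y ≡ true → T * row (complement (flip R)) y X ≤ s
    col-Q′ y y∈Q′ with cols y
    ... | inj₂ full  = full
    ... | inj₁ empty with lookup Z y in eq | proj₂ (∧-true (lookup Y y) _ (trans (sym (lookup-∩∁ Y Z y)) y∈Q′))
    ...   | false | _ = ⊥-elim (where-nearly-∁ (complement (flip R)) X y eq empty)

    in-Q′ : T * count R̄ X Q′ ≤ s * s
    in-Q′ = begin
      T * count R̄ X Q′         ≡⟨ cong (T *_) (count-flip R̄ X Q′) ⟩
      T * count (flip R̄) Q′ X  ≤⟨ count≤ (flip R̄) T s Q′ X col-Q′ ⟩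
      ∣ Q′ ∣ * s                ≤⟨ *-monoˡ-≤ s Q′≤s ⟩
      s * s                     ∎

    in-P×Q : T * (∣ P ∣ * ∣ Q ∣) ≤ 2 * (s * s)
    in-P×Q = begin
      T * (∣ P ∣ * ∣ Q ∣)                         ≡⟨ cong (T *_) (count-complement R P Q) ⟨
      T * (count R P Q + count R̄ P Q)             ≡⟨ *-distribˡ-+ T (count R P Q) _ ⟩
      T * count R P Q + T * count R̄ P Q           ≡⟨ cong (λ c → T * c + T * count R̄ P Q) (count-flip R P Q) ⟩
      T * count (flip R) Q P + T * count R̄ P Q    ≤⟨ +-mono-≤ (count≤ (flip R) T s Q P col-Q)
                                                     (count≤ R̄ T s P Q λ x x∈P → ≤-trans
                                                       (*-monoʳ-≤ T (row-mono R̄ x (p∩q⊆p Y Z))) (rows x x∈P)) ⟩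
      ∣ Q ∣ * s + ∣ P ∣ * s                       ≤⟨ +-mono-≤ (*-monoˡ-≤ s Q≤s)
                                                     (*-monoˡ-≤ s (≤-trans (p⊆q⇒∣p∣≤∣q∣ P⊆X) X≤s)) ⟩
      s * s + s * s                               ≡⟨ cong (s * s +_) (+-identityʳ (s * s)) ⟨
      2 * (s * s)                                 ∎

    -- `P` has at least half of `s ≥ ∣ X ∣` elements, so all pairs of `X × Q` together are at most
    -- twice those of `P × Q`.
    in-Q : T * count R̄ X Q ≤ 4 * (s * s)
    in-Q = begin
      T * count R̄ X Q                   ≤⟨ *-monoʳ-≤ T (m≤n+m (count R̄ X Q) (count R X Q)) ⟩
      T * (count R X Q + count R̄ X Q)   ≡⟨ cong (T *_) (count-complement R X Q) ⟩
      T * (∣ X ∣ * ∣ Q ∣)               ≤⟨ *-monoʳ-≤ T (*-monoˡ-≤ ∣ Q ∣ (≤-trans X≤s s≤2P)) ⟩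
      T * (2 * ∣ P ∣ * ∣ Q ∣)           ≡⟨ rearrange T ∣ P ∣ ∣ Q ∣ ⟩
      2 * (T * (∣ P ∣ * ∣ Q ∣))         ≤⟨ *-monoʳ-≤ 2 in-P×Q ⟩
      2 * (2 * (s * s))                 ≡⟨ *-assoc 2 2 (s * s) ⟨
      4 * (s * s)                       ∎
      where
      rearrange : ∀ t p q → t * (2 * p * q) ≡ 2 * (t * (p * q))
      rearrange = solve-∀

  -- Either the nearly full rows make up half of `X`, or the remaining rows do, and these are nearly
  -- empty. `mostly-full` applies to `R` in the first case and to `complement R` in the second.
  nearly-homogeneous : ∀ (R : Fin n → Fin n → Bool) X Y → ∣ X ∣ ≡ s → ∣ Y ∣ ≤ s →
                       (∀ x → T * row R x Y ≤ s ⊎ T * row (complement R) x Y ≤ s) →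
                       (∀ y → T * row (flip R) y X ≤ s ⊎ T * row (complement (flip R)) y X ≤ s) →
                       T * count R X Y ≤ 5 * (s * s) ⊎ T * count (complement R) X Y ≤ 5 * (s * s)
  nearly-homogeneous R X Y X≡s Y≤s rows cols with s ≤? 2 * ∣ X ∩ where-nearly R Y ∣
  ... | yes full = inj₂ (mostly-full R X Y (X ∩ Z) (≤-reflexive X≡s) Y≤s (p∩q⊆p X Z) full
      (λ x x∈P → where-nearly⁻ R Y x (proj₂ (∧-true (lookup X x) _ (trans (sym (lookup-∩ X Z x)) x∈P))))
      λ y → map-⊎ (≤-trans (≤-reflexive (cong (T *_) (row-complement² (flip R) y X)))) id (cols y))
    where
    Z = where-nearly R Y
  ... | no ¬full = inj₁ (subst (λ c → T * c ≤ 5 * (s * s)) (count-complement² R X Y)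
      (mostly-full (complement R) X Y (X ∩ ∁ Z) (≤-reflexive X≡s) Y≤s (p∩q⊆p X (∁ Z)) half empty
      λ y → swap (map-⊎ (≤-trans (≤-reflexive (cong (T *_) (row-complement² (flip R) y X))))
        (≤-trans (≤-reflexive (cong (T *_) (row-complement² (complement (flip R)) y X)))) (cols y))))
    where
    Z = where-nearly R Y

    half : s ≤ 2 * ∣ X ∩ ∁ Z ∣
    half = +-cancelˡ-≤ (2 * ∣ X ∩ Z ∣) _ _ (begin
      2 * ∣ X ∩ Z ∣ + s                        ≤⟨ +-monoˡ-≤ s (<⇒≤ (≰⇒> ¬full)) ⟩
      s + s                                    ≡⟨ cong (s +_) (+-identityʳ s) ⟨
      2 * s                                    ≡⟨ cong (2 *_) X≡s ⟨
      2 * ∣ X ∣                                ≡⟨ cong (2 *_) (∣∣-split X Z) ⟨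
      2 * (∣ X ∩ Z ∣ + ∣ X ∩ ∁ Z ∣)            ≡⟨ *-distribˡ-+ 2 ∣ X ∩ Z ∣ _ ⟩
      2 * ∣ X ∩ Z ∣ + 2 * ∣ X ∩ ∁ Z ∣          ∎)
      where open ≤-Reasoning

    empty : ∀ x → lookup (X ∩ ∁ Z) x ≡ true → Nearly (complement R) x Y
    empty x x∈P with rows x
    ... | inj₁ p = ≤-trans (≤-reflexive (cong (T *_) (row-complement² R x Y))) p
    ... | inj₂ p with lookup Z x in eq | proj₂ (∧-true (lookup X x) _ (trans (sym (lookup-∩∁ X Z x)) x∈P))
    ...   | false | _ = ⊥-elim (where-nearly-∁ R Y x eq p)

-- Filtered lists of pairs as double sums

length-filter-++ : ∀ {A : Set} {P : Pred A 0ℓ} (P? : Decidable P) xs ys →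
                   length (filter P? (xs ++ ys)) ≡ length (filter P? xs) + length (filter P? ys)
length-filter-++ P? xs ys = trans (cong length (filter-++ P? xs ys)) (length-++ (filter P? xs))

length-filter-tabulate : ∀ {A B : Set} {P : Pred B 0ℓ} (P? : Decidable P) {m} (h : A → B) (g : Fin m → A) →
  length (filter P? (List.map h (List.tabulate g))) ≡ sum (λ y → 𝟙 (does (P? (h (g y)))))
length-filter-tabulate P? {zero}  h g = sym (sum-zero _)
length-filter-tabulate P? {suc m} h g
  with length-filter-tabulate P? h (g ∘ suc) | sum-suc (λ y → 𝟙 (does (P? (h (g y)))))
... | ih | eq with does (P? (h (g zero)))
...   | true  = trans (cong suc ih) (sym eq)
...   | false = trans ih (sym eq)

length-filter-product : ∀ {A B : Set} {P : Pred (A × B) 0ℓ} (P? : Decidable P) {l m} (f : Fin l → A) (g : Fin m → B) →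
  length (filter P? (cartesianProduct (List.tabulate f) (List.tabulate g))) ≡
  sum (λ x → sum (λ y → 𝟙 (does (P? (f x , g y)))))
length-filter-product P? {zero}  f g = sym (sum-zero _)
length-filter-product P? {suc l} f g = trans
  (length-filter-++ P? (List.map (f zero ,_) (List.tabulate g)) _)
  (trans (cong₂ _+_ (length-filter-tabulate P? (f zero ,_) g) (length-filter-product P? (f ∘ suc) g))
         (sym (sum-suc _)))

does-∈? : ∀ {n} (x : Fin n) A → does (x ∈? A) ≡ lookup A x
does-∈? zero    (true  ∷ A) = refl
does-∈? zero    (false ∷ A) = refl
does-∈? (suc x) (_     ∷ A) = does-∈? x A

-- Stable graphs: splitting trees, half-graphs and rank

lookup-AllPairs : ∀ {A : Set} {R : A → A → Set} {xs} → AllPairs R xs →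
                  ∀ i j → i Fin.< j → R (List.lookup xs i) (List.lookup xs j)
lookup-AllPairs (px ∷ _)  zero    (suc j) _         = All.lookup px (∈-lookup j)
lookup-AllPairs (_ ∷ pxs) (suc i) (suc j) (s≤s i<j) = lookup-AllPairs pxs i j i<j

-- The two summands serve the two colours in `Tree-ramsey`; the extra level in each is the root that
-- is given up when passing to a child.
ramsey-height : ℕ → ℕ
ramsey-height zero    = 0
ramsey-height (suc l) = suc (ramsey-height l) + suc (ramsey-height l)

module _ {n : ℕ} (G : Graph n) where
  open Graph G

  adj : Fin n → Fin n → Bool
  adj x y = does (adj? x y)

  adj-sym : ∀ x y → adj x y ≡ adj y x
  adj-sym x y = does-⇔ (mk⇔ symm symm) (adj? x y) (adj? y x)

  e≡count : ∀ X Y → e G X Y ≡ count adj X Y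
  e≡count X Y = trans (length-filter-product _ id id) (sum-cong λ x → trans
    (sum-cong λ y → trans
      (cong₂ (λ a b → 𝟙 (a ∧ (b ∧ adj x y))) (does-∈? x X) (does-∈? y Y))
      (trans (𝟙-∧ (lookup X x) _) (cong (𝟙 (lookup X x) *_) (𝟙-∧ (lookup Y y) (adj x y)))))
    (sym (sum-*ˡ (𝟙 (lookup X x)) _)))

  N : Fin n → Subset n
  N v = tabulate (adj v)

  ∈N : ∀ {v x} → x ∈ N v → Adj v x
  ∈N {v} {x} x∈ with adj? v x | trans (sym (lookup∘tabulate (adj v) x)) ([]=⇒lookup x∈)
  ... | yes p | _ = p

  N∋ : ∀ {v x} → Adj v x → x ∈ N v
  N∋ {v} {x} p = lookup⇒[]= x (N v) (trans (lookup∘tabulate (adj v) x) (dec-true (adj? v x) p))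

  ∈∁N : ∀ {v x} → x ∈ ∁ (N v) → ¬ Adj v x
  ∈∁N x∈ p = x∈∁p⇒x∉p x∈ (N∋ p)

  ∩N : ∀ x Y → ∣ Y ∩ N x ∣ ≡ row adj x Y
  ∩N x Y = trans (∣∣-sum (Y ∩ N x)) (sum-cong λ y → trans (cong 𝟙 (lookup-∩ Y (N x) y))
    (trans (𝟙-∧ (lookup Y y) _) (cong (λ b → 𝟙 (lookup Y y) * 𝟙 b) (lookup∘tabulate (adj x) y))))

  ∩∁N : ∀ x Y → ∣ Y ∩ ∁ (N x) ∣ ≡ row (complement adj) x Y
  ∩∁N x Y = trans (∣∣-sum (Y ∩ ∁ (N x))) (sum-cong λ y → trans (cong 𝟙 (lookup-∩∁ Y (N x) y))
    (trans (𝟙-∧ (lookup Y y) _) (cong (λ b → 𝟙 (lookup Y y) * 𝟙 (not b)) (lookup∘tabulate (adj x) y))))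

  -- A full binary tree of the given height that repeatedly splits A by neighbourhoods of vertices
  -- in P, down to nonempty leaves.
  Tree : (Fin n → Set) → ℕ → Subset n → Set
  Tree P zero    A = Nonempty A
  Tree P (suc h) A = ∃[ v ] P v × Tree P h (A ∩ N v) × Tree P h (A ∩ ∁ (N v))

  Tree? : ∀ {P} → Decidable P → ∀ h A → Dec (Tree P h A)
  Tree? P? zero    A = nonempty? A
  Tree? P? (suc h) A = any? λ v → P? v ×-dec Tree? P? h (A ∩ N v) ×-dec Tree? P? h (A ∩ ∁ (N v))

  leaf : ∀ {P} h {A} → Tree P h A → Nonempty A
  leaf zero    a = a
  leaf (suc h) {A} (v , _ , t , _) with leaf h t
  ... | a , a∈ = a , proj₁ (x∈p∩q⁻ A (N v) a∈)

  ∩-monoˡ : ∀ {A B : Subset n} C → A ⊆ B → A ∩ C ⊆ B ∩ C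
  ∩-monoˡ {A} C A⊆B x∈ = let x∈A , x∈C = x∈p∩q⁻ A C x∈ in x∈p∩q⁺ (A⊆B x∈A , x∈C)

  Tree-⊆ : ∀ {P} h {A B} → A ⊆ B → Tree P h A → Tree P h B
  Tree-⊆ zero    A⊆B (a , a∈A)            = a , A⊆B a∈A
  Tree-⊆ (suc h) A⊆B (v , Pv , t₁ , t₀) =
    v , Pv , Tree-⊆ h (∩-monoˡ (N v) A⊆B) t₁ , Tree-⊆ h (∩-monoˡ (∁ (N v)) A⊆B) t₀

  -- Induct on `p + q`. The colour of the root lowers the target height of that colour in both
  -- children. If both reach it, the root joins their trees; otherwise a child has a tree of the
  -- other colour at full height, which is also a tree for the larger set `A`.
  Tree-ramsey : ∀ {P C : Fin n → Set} → (∀ v → Dec (C v)) → ∀ p q {A} → Tree P (p + q) A →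
                Tree (λ v → P v × C v) p A ⊎ Tree (λ v → P v × ¬ C v) q A
  Tree-ramsey C? zero    q       t = inj₁ (leaf q t)
  Tree-ramsey C? (suc p) zero    t = inj₂ (leaf (suc p + 0) t)
  Tree-ramsey {P} C? (suc p) (suc q) (v , Pv , t₁ , t₀) with C? v
  ... | no ¬c with Tree-ramsey C? (suc p) q (shift t₁) | Tree-ramsey C? (suc p) q (shift t₀)
    where
    shift : ∀ {B} → Tree P (p + suc q) B → Tree P (suc p + q) B
    shift {B} = subst (λ h → Tree P h B) (+-suc p q)
  ...   | inj₂ u₁ | inj₂ u₀ = inj₂ (v , (Pv , ¬c) , u₁ , u₀)
  ...   | inj₁ u₁ | _       = inj₁ (Tree-⊆ (suc p) (p∩q⊆p _ _) u₁)
  ...   | inj₂ _  | inj₁ u₀ = inj₁ (Tree-⊆ (suc p) (p∩q⊆p _ _) u₀)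
  Tree-ramsey {P} C? (suc p) (suc q) (v , Pv , t₁ , t₀)
      | yes c with Tree-ramsey C? p (suc q) t₁ | Tree-ramsey C? p (suc q) t₀
  ...   | inj₁ u₁ | inj₁ u₀ = inj₁ (v , (Pv , c) , u₁ , u₀)
  ...   | inj₂ u₁ | _       = inj₂ (Tree-⊆ (suc q) (p∩q⊆p _ _) u₁)
  ...   | inj₁ _  | inj₂ u₀ = inj₂ (Tree-⊆ (suc q) (p∩q⊆p _ _) u₀)

  -- Relates an earlier pair to a later one. Adjacency within a single pair is left open.
  HalfGraph : Fin n × Fin n → Fin n × Fin n → Set
  HalfGraph (a , v) (a′ , v′) = Adj v′ a × ¬ Adj v a′

  -- Take a leaf a and a subtree whose nodes are all adjacent or all non-adjacent to a. Passing to the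
  -- child of its root v that disagrees with a, the pair (a , v) goes before all later pairs in the
  -- first case and after them in the second.
  Tree⇒half-graph : ∀ l {P A} → Tree P (ramsey-height l) A → ∃[ xs ] length xs ≡ l ×
                    All (λ (a , v) → a ∈ A × P v) xs × AllPairs HalfGraph xs
  Tree⇒half-graph zero    t = [] , refl , [] , []
  Tree⇒half-graph (suc l) {P} {A} t with leaf (ramsey-height (suc l)) t
  -- The predicate on the nodes of the monochromatic subtree records their relation to `a`, so it is
  -- still known for the pairs found by recursion.
  ... | a , a∈A with Tree-ramsey (λ v → adj? v a) (suc (ramsey-height l)) (suc (ramsey-height l)) t
  ...   | inj₁ (v , (Pv , va) , _ , u) with Tree⇒half-graph l u
  ...     | xs , len , in-u , half = (a , v) ∷ xs , cong suc len ,
            (a∈A , Pv) ∷ All.map (λ (a′∈ , Pv′ , _) → proj₁ (x∈p∩q⁻ A _ a′∈) , Pv′) in-u ,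
            All.map (λ (a′∈ , _ , v′a) → v′a , ∈∁N (proj₂ (x∈p∩q⁻ A _ a′∈))) in-u ∷ half
  Tree⇒half-graph (suc l) {P} {A} t | a , a∈A | inj₂ (v , (Pv , ¬va) , u , _) with Tree⇒half-graph l u
  ...     | xs , len , in-u , half = xs ++ (a , v) ∷ [] ,
            trans (length-++ xs) (trans (+-comm (length xs) 1) (cong suc len)) ,
            All.++⁺ (All.map (λ (a′∈ , Pv′ , _) → proj₁ (x∈p∩q⁻ A _ a′∈) , Pv′) in-u) ((a∈A , Pv) ∷ []) ,
            AllPairs.++⁺ half ([] ∷ [])
              (All.map (λ (a′∈ , _ , ¬v′a) → (∈N (proj₂ (x∈p∩q⁻ A _ a′∈)) , ¬v′a) ∷ []) in-u)

  -- Taking the `a` from positions `2 i` and the `b` from positions `2 j + 1` avoids comparing a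
  -- pair with itself: `i ≤ j` gives `2 i < 2 j + 1`, and `j < i` gives `2 j + 1 < 2 i`.
  half-graph⇒OrderProperty : ∀ k xs → length xs ≡ 2 * k → AllPairs HalfGraph xs → OrderProperty G k
  half-graph⇒OrderProperty k xs len half =
    (λ i → proj₁ (List.lookup xs (even i))) , (λ j → proj₂ (List.lookup xs (odd j))) ,
    λ i j → mk⇔ (adj⇒≤ i j) (≤⇒adj i j)
    where
    even<odd : ∀ (i : Fin k) → suc (2 * toℕ i) < length xs
    even<odd i = subst (suc (2 * toℕ i) <_) (sym len)
      (≤-trans (≤-reflexive (sym (*-suc 2 (toℕ i)))) (*-monoʳ-≤ 2 (toℕ<n i)))

    even odd : Fin k → Fin (length xs)
    even i = fromℕ< (<⇒≤ (even<odd i))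
    odd  i = fromℕ< (even<odd i)

    ≤⇒adj : ∀ i j → i Fin.≤ j → Adj (proj₁ (List.lookup xs (even i))) (proj₂ (List.lookup xs (odd j)))
    ≤⇒adj i j i≤j = symm (proj₁ (lookup-AllPairs half (even i) (odd j)
      (subst₂ _<_ (sym (toℕ-fromℕ< _)) (sym (toℕ-fromℕ< _)) (s≤s (*-monoʳ-≤ 2 i≤j)))))

    adj⇒≤ : ∀ i j → Adj (proj₁ (List.lookup xs (even i))) (proj₂ (List.lookup xs (odd j))) → i Fin.≤ j
    adj⇒≤ i j p with toℕ i ≤? toℕ j
    ... | yes i≤j = i≤j
    ... | no  i≰j = ⊥-elim (proj₂ (lookup-AllPairs half (odd j) (even i)
      (subst₂ _<_ (sym (toℕ-fromℕ< _)) (sym (toℕ-fromℕ< _))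
        (≤-trans (≤-reflexive (sym (*-suc 2 (toℕ j)))) (*-monoʳ-≤ 2 (≰⇒> i≰j))))) (symm p))

  -- The 2-rank of stability theory, or the Littlestone dimension of the neighbourhoods of the
  -- vertices in `A`. Rank below 0 means that `A` is empty.
  Rank< : ℕ → Subset n → Set
  Rank< h A = ¬ Tree (λ _ → Unit.⊤) h A

  Stable⇒Rank< : ∀ k → Stable G k → ∀ A → Rank< (ramsey-height (2 * k)) A
  Stable⇒Rank< k stable A t with Tree⇒half-graph (2 * k) t
  ... | xs , len , _ , half = stable (half-graph⇒OrderProperty k xs len half)

  -- Trees of height `h` on both sides would join under the root `v`.
  Rank<-split : ∀ h {A} → Rank< (suc h) A → ∀ v → Rank< h (A ∩ N v) ⊎ Rank< h (A ∩ ∁ (N v))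
  Rank<-split h {A} r v with Tree? (λ _ → yes Unit.tt) h (A ∩ N v) | Tree? (λ _ → yes Unit.tt) h (A ∩ ∁ (N v))
  ... | no ¬t₁ | _      = inj₁ ¬t₁
  ... | yes _  | no ¬t₀ = inj₂ ¬t₀
  ... | yes t₁ | yes t₀ = ⊥-elim (r (v , Unit.tt , t₁ , t₀))

  Rank<-⊆ : ∀ h {A B} → A ⊆ B → Rank< h B → Rank< h A
  Rank<-⊆ h A⊆B r t = r (Tree-⊆ h A⊆B t)

-- Families of sets, with multiplicity

-- Disjointness is the bound 1 on multiplicities, and splitting sets into parts is an equation
-- between multiplicities, which adds up along concatenation.
multiplicity : ∀ {n} → Fin n → List (Subset n) → ℕ
multiplicity x 𝓕 = sumᴸ (List.map (λ A → 𝟙 (lookup A x)) 𝓕)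

total : ∀ {n} → List (Subset n) → ℕ
total 𝓕 = sumᴸ (List.map ∣_∣ 𝓕)

multiplicity-++ : ∀ {n} (x : Fin n) 𝓕 𝓖 → multiplicity x (𝓕 ++ 𝓖) ≡ multiplicity x 𝓕 + multiplicity x 𝓖
multiplicity-++ x 𝓕 𝓖 = trans (cong sumᴸ (map-++ _ 𝓕 𝓖)) (sumᴸ-++ (List.map _ 𝓕) _)

total-++ : ∀ {n} (𝓕 𝓖 : List (Subset n)) → total (𝓕 ++ 𝓖) ≡ total 𝓕 + total 𝓖
total-++ 𝓕 𝓖 = trans (cong sumᴸ (map-++ ∣_∣ 𝓕 𝓖)) (sumᴸ-++ (List.map ∣_∣ 𝓕) _)

total-sum : ∀ {n} (𝓕 : List (Subset n)) → total 𝓕 ≡ sum (λ x → multiplicity x 𝓕)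
total-sum {n} []  = sym (sum-0 n)
total-sum (A ∷ 𝓕) = trans (cong₂ _+_ (∣∣-sum A) (total-sum 𝓕))
  (sym (sum-+ (λ x → 𝟙 (lookup A x)) (λ x → multiplicity x 𝓕)))

total-cong : ∀ {n} {𝓕 𝓖 : List (Subset n)} → (∀ x → multiplicity x 𝓕 ≡ multiplicity x 𝓖) → total 𝓕 ≡ total 𝓖
total-cong {_} {𝓕} {𝓖} eq = trans (total-sum 𝓕) (trans (sum-cong eq) (sym (total-sum 𝓖)))

total≤ : ∀ {n} (𝓕 : List (Subset n)) → total 𝓕 ≤ length 𝓕 * n
total≤ []      = z≤n
total≤ (A ∷ 𝓕) = +-mono-≤ (∣p∣≤n A) (total≤ 𝓕)

-- Good sets and their extraction

module _ {n : ℕ} (G : Graph n) where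

  -- The threshold is relative to `n` and not to the size of `A`, so that subsets inherit goodness.
  Good : ℕ → Subset n → Set
  Good t A = ∀ v → t * ∣ A ∩ N G v ∣ ≤ n ⊎ t * ∣ A ∩ ∁ (N G v) ∣ ≤ n

  Good-⊆ : ∀ {t A B} → A ⊆ B → Good t B → Good t A
  Good-⊆ {t} A⊆B good v = map-⊎
    (≤-trans (*-monoʳ-≤ t (p⊆q⇒∣p∣≤∣q∣ (∩-monoˡ G (N G v) A⊆B))))
    (≤-trans (*-monoʳ-≤ t (p⊆q⇒∣p∣≤∣q∣ (∩-monoˡ G (∁ (N G v)) A⊆B)))) (good v)

  Good-≤ : ∀ {t t′ A} → t ≤ t′ → Good t′ A → Good t A
  Good-≤ {A = A} t≤t′ good v = map-⊎ (≤-trans (*-monoˡ-≤ ∣ A ∩ N G v ∣ t≤t′))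
                                     (≤-trans (*-monoˡ-≤ ∣ A ∩ ∁ (N G v) ∣ t≤t′)) (good v)

  -- A vertex that witnesses A not to be good splits off a part of smaller rank and of size more than n / t.
  extract-good : ∀ t h u {A} → Rank< G (suc h) A → t * ∣ A ∣ ≤ u * n →
    ∃[ core ] ∃[ removed ] Rank< G (suc h) core × Good t core × All (Rank< G h) removed ×
    length removed ≤ u × (∀ x → multiplicity x (core ∷ removed) ≡ 𝟙 (lookup A x))
  extract-good t h zero {A} rank small = A , [] , rank ,
    (λ v → inj₁ (≤-trans (*-monoʳ-≤ t (∣p∩q∣≤∣p∣ A (N G v))) (≤-trans small z≤n))) ,
    [] , z≤n , λ x → +-identityʳ _
  extract-good t h (suc u) {A} rank small
    with any? (λ v → n <? t * ∣ A ∩ N G v ∣ ×-dec n <? t * ∣ A ∩ ∁ (N G v) ∣)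
  ... | no ¬split = A , [] , rank , good , [] , z≤n , λ x → +-identityʳ _
    where
    good : Good t A
    good v with n <? t * ∣ A ∩ N G v ∣ | n <? t * ∣ A ∩ ∁ (N G v) ∣
    ... | no ≤n | _     = inj₁ (≮⇒≥ ≤n)
    ... | yes _ | no ≤n = inj₂ (≮⇒≥ ≤n)
    ... | yes p | yes q = ⊥-elim (¬split (v , p , q))
  ... | yes (v , big₁ , big₀) = go (Rank<-split G h rank v)
    where
    t*-split : t * ∣ A ∩ N G v ∣ + t * ∣ A ∩ ∁ (N G v) ∣ ≤ n + u * n
    t*-split = subst (_≤ n + u * n)
      (trans (cong (t *_) (sym (∣∣-split A (N G v)))) (*-distribˡ-+ t ∣ A ∩ N G v ∣ _)) small

    exchange : ∀ a b c → a + (b + c) ≡ b + (a + c)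
    exchange = solve-∀

    -- `C` is put aside and `B` is kept. As `t * ∣ C ∣` exceeds `n`, the bound on `t * ∣ B ∣` drops
    -- from `suc u * n` to `u * n`.
    continue : ∀ B C → B ⊆ A → Rank< G h C → t * ∣ B ∣ ≤ u * n →
               (∀ x → 𝟙 (lookup C x) + 𝟙 (lookup B x) ≡ 𝟙 (lookup A x)) → _
    continue B C B⊆A lower small′ parts with extract-good t h u (Rank<-⊆ G (suc h) B⊆A rank) small′
    ... | core , removed , core-rank , good , ranks , len , mult =
      core , C ∷ removed , core-rank , good , lower ∷ ranks , s≤s len ,
      λ x → trans (exchange (𝟙 (lookup core x)) (𝟙 (lookup C x)) _)
                  (trans (cong (𝟙 (lookup C x) +_) (mult x)) (parts x))

    go : Rank< G h (A ∩ N G v) ⊎ Rank< G h (A ∩ ∁ (N G v)) → _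
    go (inj₁ lower) = continue (A ∩ ∁ (N G v)) (A ∩ N G v) (p∩q⊆p A _) lower
      (+-cancelˡ-≤ n _ _ (≤-trans (+-monoˡ-≤ _ (<⇒≤ big₁)) t*-split))
      (lookup-split A (N G v))
    go (inj₂ lower) = continue (A ∩ N G v) (A ∩ ∁ (N G v)) (p∩q⊆p A _) lower
      (+-cancelʳ-≤ n _ _ (≤-trans (+-monoʳ-≤ _ (<⇒≤ big₀)) (≤-trans t*-split (≤-reflexive (+-comm n (u * n))))))
      (λ x → trans (+-comm (𝟙 (lookup (A ∩ ∁ (N G v)) x)) _) (lookup-split A (N G v) x))

  extract-all-good : ∀ t h 𝓕 → All (Rank< G (suc h)) 𝓕 →
    ∃[ cores ] ∃[ removed ] All (Rank< G (suc h)) cores × All (Good t) cores × All (Rank< G h) removed ×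
    length cores ≡ length 𝓕 × length removed ≤ length 𝓕 * t ×
    (∀ x → multiplicity x cores + multiplicity x removed ≡ multiplicity x 𝓕)
  extract-all-good t h []      []           = [] , [] , [] , [] , [] , refl , z≤n , λ x → refl
  extract-all-good t h (A ∷ 𝓕) (rank ∷ ranks)
    -- Since `∣ A ∣ ≤ n`, at most `t` parts are removed from each set.
    with extract-good t h t rank (*-monoʳ-≤ t (∣p∣≤n A)) | extract-all-good t h 𝓕 ranks
  ... | c , rs , c-rank , c-good , rs-rank , rs≤ , mult
      | cs , rss , cs-rank , cs-good , rss-rank , len , rss≤ , mults =
    c ∷ cs , rs ++ rss , c-rank ∷ cs-rank , c-good ∷ cs-good , All.++⁺ rs-rank rss-rank , cong suc len ,
    ≤-trans (≤-reflexive (length-++ rs)) (+-mono-≤ rs≤ rss≤) ,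
    λ x → trans (cong (multiplicity x (c ∷ cs) +_) (multiplicity-++ x rs rss))
      (trans (exchange (𝟙 (lookup c x)) (multiplicity x cs) (multiplicity x rs) _)
             (cong₂ _+_ (mult x) (mults x)))
    where
    exchange : ∀ a b c d → a + b + (c + d) ≡ a + c + (b + d)
    exchange = solve-∀

  -- At most h n / q vertices are lost, counted with multiplicity.
  GoodPieces : (q h : ℕ) (g : ℕ → ℕ) (R : ℕ) → List (Subset n) → Set
  GoodPieces q h g R 𝓕 = ∃[ r ] r ≤ R × ∃[ 𝓟 ] length 𝓟 ≤ r × All (Good (g r)) 𝓟 ×
    (∀ x → multiplicity x 𝓟 ≤ multiplicity x 𝓕) × q * total 𝓕 ≤ q * total 𝓟 + h * n

-- Good pieces by induction on the rank

Monotone : (ℕ → ℕ) → Set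
Monotone g = ∀ {i j} → i ≤ j → g i ≤ g j

-- The quantifier over `g` lets the induction prescribe a shifted goodness, and `R` is chosen before
-- the graph.
HasGoodPieces : (q h : ℕ) → Set₁
HasGoodPieces q h = ∀ D g → Monotone g → ∃[ R ] (∀ {n} (G : Graph n) 𝓕 → length 𝓕 ≤ D →
  All (Rank< G h) 𝓕 → GoodPieces G q h g R 𝓕)

-- The fuel u bounds how often refining the cores can still decrease their total size by more than n / q.
-- Once a step decreases it by less, the refined cores are good pieces, together with the pieces of
-- everything removed before that step.
module _ (q h : ℕ) (lower-rank : HasGoodPieces q h) (D : ℕ) (g : ℕ → ℕ) (g-mono : Monotone g) where

  refine-cores : ∀ u L → ∃[ R ] (∀ {n} (G : Graph n) cores removed → length cores ≤ D → length removed ≤ L →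
    All (Rank< G (suc h)) cores → All (Rank< G h) removed → q * total cores ≤ u * n →
    GoodPieces G q (suc h) g R (cores ++ removed))
  -- Up to `D` cores may join the `r` pieces found here, so these must be good for the parameter
  -- `r + D`.
  refine-cores u L with lower-rank L (λ r → g (r + D)) (λ i≤j → g-mono (+-monoˡ-≤ D i≤j))
  -- Without fuel `q * total cores` is 0, and the cores are dropped at no cost.
  refine-cores zero L | R , pieces = R + D , λ {n} G cores removed _ removed≤L _ ranks small →
    let r , r≤R , 𝓟 , 𝓟≤r , good , mult , loss = pieces G removed removed≤L ranks in
    r + D , +-monoˡ-≤ D r≤R , 𝓟 , ≤-trans 𝓟≤r (m≤m+n r D) , good ,
    (λ x → ≤-trans (mult x) (≤-trans (m≤n+m _ (multiplicity x cores))
      (≤-reflexive (sym (multiplicity-++ x cores removed))))) ,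
    (begin
      q * total (cores ++ removed)        ≡⟨ cong (q *_) (total-++ cores removed) ⟩
      q * (total cores + total removed)   ≡⟨ *-distribˡ-+ q (total cores) _ ⟩
      q * total cores + q * total removed ≤⟨ +-mono-≤ small loss ⟩
      q * total 𝓟 + h * n                 ≤⟨ +-monoʳ-≤ (q * total 𝓟) (m≤n+m (h * n) n) ⟩
      q * total 𝓟 + suc h * n             ∎)
    where open ≤-Reasoning
  -- Each of the at most `D` cores puts aside at most `g (R + D)` further sets.
  refine-cores (suc u) L | R , pieces with refine-cores u (L + D * g (R + D))
  ... | R′ , next = R + D + R′ , step
    where
    step : ∀ {n} (G : Graph n) cores removed → length cores ≤ D → length removed ≤ L →
           All (Rank< G (suc h)) cores → All (Rank< G h) removed → q * total cores ≤ suc u * n →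
           GoodPieces G q (suc h) g (R + D + R′) (cores ++ removed)
    step {n} G cores removed cores≤D removed≤L cores-rank removed-rank small
      -- The cores are refined for the bound `R` in place of the actual `r`; monotonicity of `g`
      -- makes them good for `r + D` as well.
      with extract-all-good G (g (R + D)) h cores cores-rank
    ... | cores′ , new , cores′-rank , cores′-good , new-rank , len , new≤ , mult′
      with q * total cores′ ≤? u * n
    ... | yes small′ =
      let r , r≤R , 𝓟 , 𝓟≤r , good , mult , loss = next G cores′ (new ++ removed)
            (≤-trans (≤-reflexive len) cores≤D)
            (≤-trans (≤-reflexive (trans (length-++ new) (+-comm (length new) _)))
                     (+-mono-≤ removed≤L (≤-trans new≤ (*-monoˡ-≤ _ cores≤D))))
            cores′-rank (All.++⁺ new-rank removed-rank) small′
      in r , ≤-trans r≤R (m≤n+m R′ (R + D)) , 𝓟 , 𝓟≤r , good ,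
         (λ x → ≤-trans (mult x) (≤-reflexive (same x))) ,
         subst (λ a → q * a ≤ q * total 𝓟 + suc h * n)
           (total-cong {𝓕 = cores′ ++ new ++ removed} {cores ++ removed} same) loss
      where
      same : ∀ x → multiplicity x (cores′ ++ new ++ removed) ≡ multiplicity x (cores ++ removed)
      same x = trans (multiplicity-++ x cores′ _)
        (trans (cong (multiplicity x cores′ +_) (multiplicity-++ x new removed))
        (trans (sym (+-assoc (multiplicity x cores′) _ _))
        (trans (cong (_+ multiplicity x removed) (mult′ x)) (sym (multiplicity-++ x cores removed)))))
    -- The sets in `new` are discarded. Their total size, times `q`, is at most `n`, which raises
    -- the loss from `h * n` to `suc h * n`.
    ... | no large =
      let r , r≤R , 𝓟 , 𝓟≤r , good , mult , loss = pieces G removed removed≤L removed-rank in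
      r + D , ≤-trans (+-monoˡ-≤ D r≤R) (m≤m+n (R + D) R′) , cores′ ++ 𝓟 ,
      ≤-trans (≤-reflexive (trans (length-++ cores′) (+-comm (length cores′) _)))
              (+-mono-≤ 𝓟≤r (≤-trans (≤-reflexive len) cores≤D)) ,
      All.++⁺ (All.map (λ {A} → Good-≤ G {A = A} (g-mono (+-monoˡ-≤ D r≤R))) cores′-good) good ,
      (λ x → ≤-trans (≤-reflexive (multiplicity-++ x cores′ 𝓟)) (≤-trans
        (+-mono-≤ (≤-trans (m≤m+n (multiplicity x cores′) _) (≤-reflexive (mult′ x))) (mult x))
        (≤-reflexive (sym (multiplicity-++ x cores removed))))) ,
      (begin
        q * total (cores ++ removed)                ≡⟨ cong (q *_) (total-++ cores removed) ⟩
        q * (total cores + total removed)           ≡⟨ *-distribˡ-+ q (total cores) _ ⟩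
        q * total cores + q * total removed         ≤⟨ +-mono-≤ small loss ⟩
        n + u * n + (q * total 𝓟 + h * n)           ≤⟨ +-monoˡ-≤ _ (+-monoʳ-≤ n (<⇒≤ (≰⇒> large))) ⟩
        n + q * total cores′ + (q * total 𝓟 + h * n) ≡⟨ rearrange n q (total cores′) (total 𝓟) h ⟩
        q * (total cores′ + total 𝓟) + suc h * n    ≡⟨ cong (λ a → q * a + suc h * n) (total-++ cores′ 𝓟) ⟨
        q * total (cores′ ++ 𝓟) + suc h * n         ∎)
      where
      open ≤-Reasoning
      rearrange : ∀ n q a b h → n + q * a + (q * b + h * n) ≡ q * (a + b) + (1 + h) * n
      rearrange = solve-∀

-- In the base case all sets are empty. In the step the given sets are the initial cores and nothing
-- is removed yet; their total size is at most `D * n`, hence the fuel `q * D`.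
good-pieces : ∀ q h → HasGoodPieces q h
good-pieces q zero    D g g-mono = 0 , λ {n} G 𝓕 _ ranks → 0 , z≤n , [] , z≤n , [] , (λ x → z≤n) ,
  ≤-trans (≤-reflexive (cong (q *_) (empty G 𝓕 ranks))) (m≤m+n (q * 0) (0 * n))
  where
  empty : ∀ {n} (G : Graph n) 𝓕 → All (Rank< G 0) 𝓕 → total 𝓕 ≡ 0
  empty G []      []             = refl
  empty {n} G (A ∷ 𝓕) (rank ∷ ranks) = cong₂ _+_ (trans (cong ∣_∣ (Empty-unique rank)) (∣⊥∣≡0 n)) (empty G 𝓕 ranks)
good-pieces q (suc h) D g g-mono with refine-cores q h (good-pieces q h) D g g-mono (q * D) 0
... | R , pieces = R , λ {n} G 𝓕 𝓕≤D ranks → subst (GoodPieces G q (suc h) g R) (++-identityʳ 𝓕)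
  (pieces G 𝓕 [] 𝓕≤D z≤n ranks [] (≤-trans (*-monoʳ-≤ q (≤-trans (total≤ 𝓕) (*-monoˡ-≤ n 𝓕≤D)))
    (≤-reflexive (sym (*-assoc q D n)))))

-- Cutting sets into parts of equal size

𝟙≤⇒⊆ : ∀ {n} {A B : Subset n} → (∀ x → 𝟙 (lookup A x) ≤ 𝟙 (lookup B x)) → A ⊆ B
𝟙≤⇒⊆ {A = A} {B} A≤B {x} x∈A with lookup B x in eq | subst (λ b → 𝟙 b ≤ 𝟙 (lookup B x)) ([]=⇒lookup x∈A) (A≤B x)
... | true  | _ = lookup⇒[]= x B eq

∣∣-parts : ∀ {n} (A B C : Subset n) → (∀ x → 𝟙 (lookup B x) + 𝟙 (lookup C x) ≡ 𝟙 (lookup A x)) → ∣ B ∣ + ∣ C ∣ ≡ ∣ A ∣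
∣∣-parts A B C parts = trans (cong₂ _+_ (∣∣-sum B) (∣∣-sum C))
  (trans (sym (sum-+ (λ x → 𝟙 (lookup B x)) (λ x → 𝟙 (lookup C x)))) (trans (sum-cong parts) (sym (∣∣-sum A))))

split-at : ∀ {n} s (A : Subset n) → s ≤ ∣ A ∣ →
           ∃[ B ] ∃[ C ] ∣ B ∣ ≡ s × (∀ x → 𝟙 (lookup B x) + 𝟙 (lookup C x) ≡ 𝟙 (lookup A x))
split-at {n} zero A _ = ⊥ , A , ∣⊥∣≡0 n , λ x → cong (λ b → 𝟙 b + 𝟙 (lookup A x)) (lookup-replicate x false)
split-at (suc s) (true ∷ A) (s≤s s≤A) with split-at s A s≤A
... | B , C , size , parts = true ∷ B , false ∷ C , cong suc size , λ { zero → refl ; (suc x) → parts x }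
split-at (suc s) (false ∷ A) s≤A with split-at (suc s) A s≤A
... | B , C , size , parts = false ∷ B , false ∷ C , size , λ { zero → refl ; (suc x) → parts x }

-- Parts of size `suc s` are split off greedily while more than `s` elements remain; `u` bounds the
-- recursion.
chop : ∀ {n} s u (A : Subset n) → ∣ A ∣ ≤ u →
       ∃[ 𝓦 ] All (λ W → ∣ W ∣ ≡ suc s × W ⊆ A) 𝓦 ×
       (∀ x → multiplicity x 𝓦 ≤ 𝟙 (lookup A x)) × ∣ A ∣ ≤ total 𝓦 + s
chop s u A A≤u with ∣ A ∣ ≤? s
... | yes A≤s = [] , [] , (λ x → z≤n) , A≤s
chop s zero    A A≤u | no A≰s = ⊥-elim (A≰s (≤-trans A≤u z≤n))
chop s (suc u) A A≤u | no A≰s with split-at (suc s) A (≰⇒> A≰s)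
... | B , C , size , parts with ∣∣-parts A B C parts
...   | sizes with chop s u C (≤-pred (≤-trans (s≤s (m≤n+m ∣ C ∣ s))
                    (≤-trans (≤-reflexive (trans (cong (_+ ∣ C ∣) (sym size)) sizes)) A≤u)))
...     | 𝓦 , each , mult , leftover = B ∷ 𝓦 ,
  (size , 𝟙≤⇒⊆ {A = B} {A} (λ x → ≤-trans (m≤m+n _ (𝟙 (lookup C x))) (≤-reflexive (parts x)))) ∷
    All.map (λ (size′ , W⊆C) → size′ , λ {x} x∈W → 𝟙≤⇒⊆ {A = C} {A}
      (λ x → ≤-trans (m≤n+m _ (𝟙 (lookup B x))) (≤-reflexive (parts x))) (W⊆C x∈W)) each ,
  (λ x → ≤-trans (+-monoʳ-≤ (𝟙 (lookup B x)) (mult x)) (≤-reflexive (parts x))) ,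
  (begin
    ∣ A ∣                   ≡⟨ sizes ⟨
    ∣ B ∣ + ∣ C ∣           ≤⟨ +-monoʳ-≤ ∣ B ∣ leftover ⟩
    ∣ B ∣ + (total 𝓦 + s)   ≡⟨ +-assoc ∣ B ∣ (total 𝓦) s ⟨
    ∣ B ∣ + total 𝓦 + s     ∎)
  where
  open ≤-Reasoning

chop-all : ∀ {n} s (P : Subset n → Set) → (∀ {A B} → A ⊆ B → P B → P A) → ∀ 𝓟 → All P 𝓟 →
           ∃[ 𝓦 ] All (λ W → ∣ W ∣ ≡ suc s × P W) 𝓦 ×
           (∀ x → multiplicity x 𝓦 ≤ multiplicity x 𝓟) × total 𝓟 ≤ total 𝓦 + length 𝓟 * s
chop-all s P P-⊆ []      []           = [] , [] , (λ x → z≤n) , z≤n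
chop-all s P P-⊆ (A ∷ 𝓟) (PA ∷ P𝓟) with chop s ∣ A ∣ A ≤-refl | chop-all s P P-⊆ 𝓟 P𝓟
... | 𝓥 , each , mult , leftover | 𝓦 , each′ , mult′ , leftover′ = 𝓥 ++ 𝓦 ,
  All.++⁺ (All.map (λ (size , W⊆A) → size , P-⊆ W⊆A PA) each) each′ ,
  (λ x → ≤-trans (≤-reflexive (multiplicity-++ x 𝓥 𝓦)) (+-mono-≤ (mult x) (mult′ x))) ,
  (begin
    ∣ A ∣ + total 𝓟                              ≤⟨ +-mono-≤ leftover leftover′ ⟩
    total 𝓥 + s + (total 𝓦 + length 𝓟 * s)       ≡⟨ exchange (total 𝓥) s (total 𝓦) _ ⟩
    total 𝓥 + total 𝓦 + (s + length 𝓟 * s)       ≡⟨ cong (_+ (s + length 𝓟 * s)) (total-++ 𝓥 𝓦) ⟨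
    total (𝓥 ++ 𝓦) + (s + length 𝓟 * s)          ∎)
  where
  open ≤-Reasoning
  exchange : ∀ a b c d → a + b + (c + d) ≡ a + c + (b + d)
  exchange = solve-∀

total-equal-sizes : ∀ {n s} {𝓦 : List (Subset n)} → All (λ W → ∣ W ∣ ≡ s) 𝓦 → total 𝓦 ≡ length 𝓦 * s
total-equal-sizes []            = refl
total-equal-sizes (size ∷ sizes) = cong₂ _+_ size (total-equal-sizes sizes)

-- From a disjoint family to a partition

module _ {n : ℕ} where

  uncovered : List (Subset n) → Subset n
  uncovered 𝓦 = tabulate λ x → multiplicity x 𝓦 ≡ᵇ 0

  ∈uncovered⁻ : ∀ {x : Fin n} (𝓦 : List (Subset n)) → x ∈ uncovered 𝓦 → multiplicity x 𝓦 ≡ 0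
  ∈uncovered⁻ {x} 𝓦 x∈
    with multiplicity x 𝓦 | trans (sym (lookup∘tabulate (λ x → multiplicity x 𝓦 ≡ᵇ 0) x)) ([]=⇒lookup x∈)
  ... | zero | _ = refl

  ∈uncovered⁺ : ∀ {x : Fin n} (𝓦 : List (Subset n)) → multiplicity x 𝓦 ≡ 0 → x ∈ uncovered 𝓦
  ∈uncovered⁺ {x} 𝓦 p = lookup⇒[]= x _ (trans (lookup∘tabulate (λ x → multiplicity x 𝓦 ≡ᵇ 0) x) (cong (_≡ᵇ 0) p))

  classes : (𝓦 : List (Subset n)) → Fin (suc (length 𝓦)) → Subset n
  classes 𝓦 zero    = uncovered 𝓦
  classes 𝓦 (suc i) = List.lookup 𝓦 i

  covered : ∀ (x : Fin n) (𝓦 : List (Subset n)) → 1 ≤ multiplicity x 𝓦 → ∃[ i ] x ∈ List.lookup 𝓦 i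
  covered x (W ∷ 𝓦) pos with lookup W x in eq
  ... | true  = zero , lookup⇒[]= x W eq
  ... | false = let i , x∈ = covered x 𝓦 pos in suc i , x∈

  ∈⇒1≤multiplicity : ∀ {x : Fin n} (𝓦 : List (Subset n)) i → x ∈ List.lookup 𝓦 i → 1 ≤ multiplicity x 𝓦
  ∈⇒1≤multiplicity {x} (W ∷ 𝓦) zero    x∈ =
    ≤-trans (≤-reflexive (cong 𝟙 (sym ([]=⇒lookup x∈)))) (m≤m+n (𝟙 (lookup W x)) _)
  ∈⇒1≤multiplicity {x} (W ∷ 𝓦) (suc i) x∈ = ≤-trans (∈⇒1≤multiplicity 𝓦 i x∈) (m≤n+m _ (𝟙 (lookup W x)))

  not-twice : ∀ {x : Fin n} W (𝓦 : List (Subset n)) i → multiplicity x (W ∷ 𝓦) ≤ 1 → x ∈ W → ¬ x ∈ List.lookup 𝓦 i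
  not-twice {x} W 𝓦 i ≤1 x∈W x∈ = <-irrefl refl (≤-trans
    (+-mono-≤ (≤-reflexive (cong 𝟙 (sym ([]=⇒lookup x∈W)))) (∈⇒1≤multiplicity 𝓦 i x∈)) ≤1)

  unique-index : ∀ {x : Fin n} (𝓦 : List (Subset n)) i j → multiplicity x 𝓦 ≤ 1 →
                 x ∈ List.lookup 𝓦 i → x ∈ List.lookup 𝓦 j → i ≡ j
  unique-index (W ∷ 𝓦) zero    zero    ≤1 x∈ x∈′ = refl
  unique-index (W ∷ 𝓦) zero    (suc j) ≤1 x∈ x∈′ = ⊥-elim (not-twice W 𝓦 j ≤1 x∈ x∈′)
  unique-index (W ∷ 𝓦) (suc i) zero    ≤1 x∈ x∈′ = ⊥-elim (not-twice W 𝓦 i ≤1 x∈′ x∈)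
  unique-index {x} (W ∷ 𝓦) (suc i) (suc j) ≤1 x∈ x∈′ =
    cong suc (unique-index 𝓦 i j (≤-trans (m≤n+m _ (𝟙 (lookup W x))) ≤1) x∈ x∈′)

  classes-partition : ∀ (𝓦 : List (Subset n)) → (∀ x → multiplicity x 𝓦 ≤ 1) → All Nonempty 𝓦 →
                      IsPartition (classes 𝓦)
  classes-partition 𝓦 ≤1 inhabited = record
    { cover-disjoint = λ x → class x (multiplicity x 𝓦 ≟ 0)
    ; nonempty       = λ i → All.lookup inhabited (∈-lookup i)
    }
    where
    class : ∀ x → Dec (multiplicity x 𝓦 ≡ 0) → ∃! _≡_ λ i → x ∈ classes 𝓦 i
    class x (yes 0≡) = zero , ∈uncovered⁺ 𝓦 0≡ , λ
      { {zero}  _  → refl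
      ; {suc j} x∈ → ⊥-elim (<⇒≢ (∈⇒1≤multiplicity 𝓦 j x∈) (sym 0≡)) }
    class x (no ≢0) with covered x 𝓦 (n≢0⇒n>0 ≢0)
    ... | i , x∈ = suc i , x∈ , λ
      { {zero}  x∈′ → ⊥-elim (≢0 (∈uncovered⁻ 𝓦 x∈′))
      ; {suc j} x∈′ → cong suc (unique-index 𝓦 i j (≤1 x) x∈ x∈′) }

  -- At each vertex the indicator of being uncovered and the multiplicity add up to at most 1.
  uncovered-size : ∀ (𝓦 : List (Subset n)) → (∀ x → multiplicity x 𝓦 ≤ 1) → ∣ uncovered 𝓦 ∣ + total 𝓦 ≤ n
  uncovered-size 𝓦 ≤1 = begin
    ∣ uncovered 𝓦 ∣ + total 𝓦   ≡⟨ cong₂ _+_ (∣∣-sum (uncovered 𝓦)) (total-sum 𝓦) ⟩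
    sum (λ x → 𝟙 (lookup (uncovered 𝓦) x)) + sum (λ x → multiplicity x 𝓦)
                                ≡⟨ sum-+ (λ x → 𝟙 (lookup (uncovered 𝓦) x)) (λ x → multiplicity x 𝓦) ⟨
    sum (λ x → 𝟙 (lookup (uncovered 𝓦) x) + multiplicity x 𝓦)
                                ≤⟨ sum-mono pointwise ⟩
    sum (λ x → 𝟙 (lookup ⊤ x))  ≡⟨ ∣∣-sum (⊤ {n}) ⟨
    ∣ ⊤ {n} ∣                   ≡⟨ ∣⊤∣≡n n ⟩
    n                           ∎
    where
    open ≤-Reasoning
    pointwise : ∀ x → 𝟙 (lookup (uncovered 𝓦) x) + multiplicity x 𝓦 ≤ 𝟙 (lookup ⊤ x)
    pointwise x rewrite lookup∘tabulate (λ x → multiplicity x 𝓦 ≡ᵇ 0) x | lookup-replicate x true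
      with multiplicity x 𝓦 | ≤1 x
    ... | zero  | _  = ≤-refl
    ... | suc _ | ≤1 = ≤1

size⇒Nonempty : ∀ {n s} {A : Subset n} → ∣ A ∣ ≡ suc s → Nonempty A
size⇒Nonempty {n} {s} {A} size with nonempty? A
... | yes p = p
... | no ¬p with trans (sym size) (trans (cong ∣_∣ (Empty-unique ¬p)) (∣⊥∣≡0 n))
...   | ()

-- The homogeneous partition

-- A monotone majorant of an arbitrary `F`: goodness is prescribed when only a bound on the number
-- of parts is known.
cumulative : (ℕ → ℕ) → ℕ → ℕ
cumulative F zero    = F zero
cumulative F (suc m) = F (suc m) + cumulative F m

cumulative-mono : ∀ F → Monotone (cumulative F)
cumulative-mono F {i} {j} i≤j with m≤n⇒∃[o]m+o≡n i≤j
... | o , refl = go o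
  where
  go : ∀ o → cumulative F i ≤ cumulative F (i + o)
  go zero    = ≤-reflexive (cong (cumulative F) (sym (+-identityʳ i)))
  go (suc o) rewrite +-suc i o = ≤-trans (go o) (m≤n+m _ (F (suc (i + o))))

≤cumulative : ∀ F m → F m ≤ cumulative F m
≤cumulative F zero    = ≤-refl
≤cumulative F (suc m) = m≤m+n (F (suc m)) _

n<[1+n/K]*K : ∀ n K .{{_ : NonZero K}} → n < suc (n / K) * K
n<[1+n/K]*K n K = subst (_< suc (n / K) * K) (sym (m≡m%n+[m/n]*n n K)) (+-monoˡ-< (n / K * K) (m%n<n n K))

module _ {n : ℕ} (G : Graph n) where

  -- For positive `F`: density within `1 / F` of 0 or of 1, written without division.
  Homogeneous : ℕ → Subset n → Subset n → Set
  Homogeneous F X Y = F * count (adj G) X Y ≤ ∣ X ∣ * ∣ Y ∣ ⊎ F * count (complement (adj G)) X Y ≤ ∣ X ∣ * ∣ Y ∣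

  -- As `n < s * K`, the factor `K` turns the threshold relative to `n` into one relative to `s`;
  -- the factor 5 pays for the loss in `nearly-homogeneous`. Columns behave like rows because
  -- adjacency is symmetric.
  Good-homogeneous : ∀ F K s X Y → .{{NonZero K}} → n < s * K → ∣ X ∣ ≡ s → ∣ Y ∣ ≡ s →
                     Good G (K * (5 * F)) X → Good G (K * (5 * F)) Y → Homogeneous F X Y
  Good-homogeneous F K s X Y n<sK X≡s Y≡s X-good Y-good = map-⊎ cancel cancel
    (nearly-homogeneous (5 * F) s (adj G) X Y X≡s (≤-reflexive Y≡s) (constant {Y} Y-good)
      λ y → map-⊎ (subst (λ a → 5 * F * a ≤ s) (sum-cong λ x → cong (λ b → 𝟙 (lookup X x) * 𝟙 b) (adj-sym G y x)))
                  (subst (λ a → 5 * F * a ≤ s)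
                    (sum-cong λ x → cong (λ b → 𝟙 (lookup X x) * 𝟙 (not b)) (adj-sym G y x)))
                  (constant {X} X-good y))
    where
    cancel : ∀ {c} → 5 * F * c ≤ 5 * (s * s) → F * c ≤ ∣ X ∣ * ∣ Y ∣
    cancel {c} le rewrite X≡s | Y≡s = *-cancelˡ-≤ 5 (≤-trans (≤-reflexive (sym (*-assoc 5 F c))) le)

    scale : ∀ {a} → K * (5 * F) * a ≤ n → 5 * F * a ≤ s
    scale {a} le = <⇒≤ (*-cancelʳ-< K (5 * F * a) s (≤-<-trans (≤-trans (≤-reflexive (rearrange F a K)) le) n<sK))
      where
      rearrange : ∀ F a K → 5 * F * a * K ≡ K * (5 * F) * a
      rearrange = solve-∀

    constant : ∀ {Z} → Good G (K * (5 * F)) Z → ∀ v →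
               5 * F * row (adj G) v Z ≤ s ⊎ 5 * F * row (complement (adj G)) v Z ≤ s
    constant {Z} good v = map-⊎ (scale ∘ subst (λ a → K * (5 * F) * a ≤ n) (∩N G v Z))
                                (scale ∘ subst (λ a → K * (5 * F) * a ≤ n) (∩∁N G v Z)) (good v)

-- Pieces obtained with parameter r are cut into parts of size 1 + ⌊ n / K ⌋, where K = 1 + 2 r E; hence
-- there are fewer than K parts, and at most r n / K ≤ n / 2 E vertices are left over.
homogeneous-partition : ∀ k E (F : ℕ → ℕ) → ∃[ M ] (∀ {n} (G : Graph n) → Stable G k →
  ∃[ m ] m ≤ M × ∃[ W ] IsPartition {m = m} W × E * ∣ W zero ∣ ≤ n ×
  (∀ i j → Homogeneous G (F m) (W (suc i)) (W (suc j)) × ∣ W (suc i) ∣ ≡ ∣ W (suc j) ∣))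
homogeneous-partition k E F = K (proj₁ pieces) , λ G stable →
  partition G (proj₂ pieces G (⊤ ∷ []) ≤-refl (Stable⇒Rank< G k stable ⊤ ∷ []))
  where
  h = ramsey-height (2 * k)
  -- Half of the exceptional set is allotted to the loss `h * n` of the rank induction and half to
  -- cutting. Using `suc h` makes the factor `suc h * 2` positive, so that it cancels in
  -- `exceptional`.
  q = suc h * (2 * E)

  K : ℕ → ℕ
  K r = suc (r * (2 * E))

  K-mono : Monotone K
  K-mono i≤j = s≤s (*-monoˡ-≤ (2 * E) i≤j)

  -- The goodness that `Good-homogeneous` needs for parts of size above `n / K r`, whatever their
  -- number up to `K r`.
  g : ℕ → ℕ
  g r = K r * (5 * cumulative F (K r))

  pieces = good-pieces q h 1 g λ i≤j →
    *-mono-≤ (K-mono i≤j) (*-monoʳ-≤ 5 (cumulative-mono F (K-mono i≤j)))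

  partition : ∀ {n} (G : Graph n) → GoodPieces G q h g (proj₁ pieces) (⊤ ∷ []) →
    ∃[ m ] m ≤ K (proj₁ pieces) × ∃[ W ] IsPartition {m = m} W × E * ∣ W zero ∣ ≤ n ×
    (∀ i j → Homogeneous G (F m) (W (suc i)) (W (suc j)) × ∣ W (suc i) ∣ ≡ ∣ W (suc j) ∣)
  partition {n} G (r , r≤R , 𝓟 , 𝓟≤r , good , mult , loss)
    with chop-all (n / K r) (Good G (g r)) (λ {A} {B} → Good-⊆ G {t = g r} {A} {B}) 𝓟 good
  ... | 𝓦 , each , mult′ , leftover = length 𝓦 , ≤-trans (<⇒≤ few) (K-mono r≤R) , classes 𝓦 ,
    classes-partition 𝓦 disjoint (All.map (λ (size , _) → size⇒Nonempty size) each) ,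
    exceptional ,
    λ i j → let sizeᵢ , goodᵢ = All.lookup each (∈-lookup i)
                sizeⱼ , goodⱼ = All.lookup each (∈-lookup j)
            in map-⊎ (≤-trans (*-monoˡ-≤ _ F≤)) (≤-trans (*-monoˡ-≤ _ F≤))
                 (Good-homogeneous G (cumulative F (K r)) (K r) s (List.lookup 𝓦 i) (List.lookup 𝓦 j) n<sK
                   sizeᵢ sizeⱼ goodᵢ goodⱼ) ,
               trans sizeᵢ (sym sizeⱼ)
    where
    open ≤-Reasoning
    s = suc (n / K r)

    n<sK : n < s * K r
    n<sK = n<[1+n/K]*K n (K r)

    disjoint : ∀ x → multiplicity x 𝓦 ≤ 1
    disjoint x = ≤-trans (mult′ x) (≤-trans (mult x) (≤-reflexive (cong (λ b → 𝟙 b + 0) (lookup-replicate x true))))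

    few : length 𝓦 < K r
    few = *-cancelʳ-< s (length 𝓦) (K r) (begin-strict
      length 𝓦 * s                ≡⟨ total-equal-sizes (All.map proj₁ each) ⟨
      total 𝓦                     ≤⟨ m≤n+m (total 𝓦) ∣ uncovered 𝓦 ∣ ⟩
      ∣ uncovered 𝓦 ∣ + total 𝓦   ≤⟨ uncovered-size 𝓦 disjoint ⟩
      n                           <⟨ n<sK ⟩
      s * K r                     ≡⟨ *-comm s (K r) ⟩
      K r * s                     ∎)

    F≤ : F (length 𝓦) ≤ cumulative F (K r)
    F≤ = ≤-trans (≤cumulative F (length 𝓦)) (cumulative-mono F (<⇒≤ few))

    cut-off : r * (2 * E) * (n / K r) ≤ n
    cut-off = ≤-trans (*-monoˡ-≤ (n / K r) (n≤1+n (r * (2 * E))))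
      (≤-trans (≤-reflexive (*-comm (K r) (n / K r))) (m/n*n≤m n (K r)))

    exceptional : E * ∣ uncovered 𝓦 ∣ ≤ n
    exceptional = *-cancelˡ-≤ (suc h * 2) (+-cancelʳ-≤ (q * total 𝓦) _ _ (begin
      suc h * 2 * (E * u) + q * total 𝓦                       ≡⟨ rearrange₁ (suc h) E u (total 𝓦) ⟩
      q * (u + total 𝓦)                                       ≤⟨ *-monoʳ-≤ q (uncovered-size 𝓦 disjoint) ⟩
      q * n                                                   ≡⟨ cong (q *_) (trans (+-identityʳ _) (∣⊤∣≡n n)) ⟨
      q * total (⊤ {n} ∷ [])                                  ≤⟨ loss ⟩
      q * total 𝓟 + h * n                                     ≤⟨ +-mono-≤ (*-monoʳ-≤ q (≤-trans leftover
                                                                   (+-monoʳ-≤ (total 𝓦) (*-monoˡ-≤ (n / K r) 𝓟≤r))))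
                                                                   (*-monoˡ-≤ n (n≤1+n h)) ⟩
      q * (total 𝓦 + r * (n / K r)) + suc h * n               ≡⟨ rearrange₂ (suc h) E (total 𝓦) r (n / K r) n ⟩
      suc h * (r * (2 * E) * (n / K r)) + suc h * n + q * total 𝓦
                                                              ≤⟨ +-monoˡ-≤ _ (+-monoˡ-≤ _ (*-monoʳ-≤ (suc h) cut-off)) ⟩
      suc h * n + suc h * n + q * total 𝓦                     ≡⟨ cong (_+ q * total 𝓦) (double (suc h) n) ⟩
      suc h * 2 * n + q * total 𝓦                             ∎))
      where
      u = ∣ uncovered 𝓦 ∣
      rearrange₁ : ∀ h E u t → h * 2 * (E * u) + h * (2 * E) * t ≡ h * (2 * E) * (u + t)
      rearrange₁ = solve-∀
      rearrange₂ : ∀ h E t r s n → h * (2 * E) * (t + r * s) + h * n ≡ h * (r * (2 * E) * s) + h * n + h * (2 * E) * t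
      rearrange₂ = solve-∀
      double : ∀ h n → h * n + h * n ≡ h * 2 * n
      double = solve-∀

-- Rational densities and real bounds

-- Equations between normalised rationals are moved to unnormalised ones, where they become
-- identities of integers.
fromℕ-toℚᵘ : ∀ n → toℚᵘ (fromℕ n) ℚᵘ.≃ mkℚᵘ (ℤ.+ n) 0
fromℕ-toℚᵘ n = ℚₚ.toℚᵘ-fromℚᵘ (mkℚᵘ (ℤ.+ n) 0)

ratio-toℚᵘ : ∀ a b → toℚᵘ (ratio a (suc b)) ℚᵘ.≃ mkℚᵘ (ℤ.+ a) b
ratio-toℚᵘ a b = ℚₚ.toℚᵘ-fromℚᵘ (mkℚᵘ (ℤ.+ a) b)

fromℕ-+ : ∀ m n → fromℕ (m + n) ≡ fromℕ m ℚ.+ fromℕ n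
fromℕ-+ m n = ℚₚ.toℚᵘ-injective (begin
  toℚᵘ (fromℕ (m + n))                    ≈⟨ fromℕ-toℚᵘ (m + n) ⟩
  mkℚᵘ (ℤ.+ (m + n)) 0                    ≈⟨ *≡* (identity (ℤ.+ m) (ℤ.+ n)) ⟩
  mkℚᵘ (ℤ.+ m) 0 ℚᵘ.+ mkℚᵘ (ℤ.+ n) 0      ≈⟨ ℚᵘₚ.+-cong (fromℕ-toℚᵘ m) (fromℕ-toℚᵘ n) ⟨
  toℚᵘ (fromℕ m) ℚᵘ.+ toℚᵘ (fromℕ n)      ≈⟨ ℚₚ.toℚᵘ-homo-+ (fromℕ m) (fromℕ n) ⟨
  toℚᵘ (fromℕ m ℚ.+ fromℕ n)              ∎)
  where
  open ℚᵘₚ.≃-Reasoning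
  identity : ∀ a b → (a ℤ.+ b) ℤ.* ℤ.+ 1 ≡ (a ℤ.* ℤ.+ 1 ℤ.+ b ℤ.* ℤ.+ 1) ℤ.* ℤ.+ 1
  identity = ℤ-Ring.solve-∀

fromℕ-* : ∀ m n → fromℕ (m * n) ≡ fromℕ m ℚ.* fromℕ n
fromℕ-* m n = ℚₚ.toℚᵘ-injective (begin
  toℚᵘ (fromℕ (m * n))                    ≈⟨ fromℕ-toℚᵘ (m * n) ⟩
  mkℚᵘ (ℤ.+ (m * n)) 0                    ≈⟨ *≡* (cong (ℤ._* ℤ.+ 1) (ℤₚ.pos-* m n)) ⟩
  mkℚᵘ (ℤ.+ m) 0 ℚᵘ.* mkℚᵘ (ℤ.+ n) 0      ≈⟨ ℚᵘₚ.*-cong (fromℕ-toℚᵘ m) (fromℕ-toℚᵘ n) ⟨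
  toℚᵘ (fromℕ m) ℚᵘ.* toℚᵘ (fromℕ n)      ≈⟨ ℚₚ.toℚᵘ-homo-* (fromℕ m) (fromℕ n) ⟨
  toℚᵘ (fromℕ m ℚ.* fromℕ n)              ∎)
  where open ℚᵘₚ.≃-Reasoning

0≤fromℕ : ∀ n → 0ℚ ℚ.≤ fromℕ n
0≤fromℕ n = ℚₚ.toℚᵘ-cancel-≤
  (ℚᵘₚ.≤-respʳ-≃ (ℚᵘₚ.≃-sym (fromℕ-toℚᵘ n)) (ℚᵘₚ.nonNegative⁻¹ (mkℚᵘ (ℤ.+ n) 0)))

fromℕ-nonNeg : ∀ n → ℚ.NonNegative (fromℕ n)
fromℕ-nonNeg n = ℚ.nonNegative (0≤fromℕ n)

fromℕ-mono-≤ : ∀ {m n} → m ≤ n → fromℕ m ℚ.≤ fromℕ n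
fromℕ-mono-≤ {m} m≤n with m≤n⇒∃[o]m+o≡n m≤n
... | o , refl = subst₂ ℚ._≤_ (ℚₚ.+-identityʳ (fromℕ m)) (sym (fromℕ-+ m o))
                   (ℚₚ.+-monoʳ-≤ (fromℕ m) (0≤fromℕ o))

ratio-nonNeg : ∀ a b → ℚ.NonNegative (ratio a b)
ratio-nonNeg a zero    = ℚ.nonNegative ℚₚ.≤-refl
ratio-nonNeg a (suc b) = ℚ.nonNegative (ℚₚ.toℚᵘ-cancel-≤
  (ℚᵘₚ.≤-respʳ-≃ (ℚᵘₚ.≃-sym (ratio-toℚᵘ a b)) (ℚᵘₚ.nonNegative⁻¹ (mkℚᵘ (ℤ.+ a) b))))

ratio-* : ∀ a b → .{{_ : NonZero b}} → ratio a b ℚ.* fromℕ b ≡ fromℕ a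
ratio-* a (suc b) = ℚₚ.toℚᵘ-injective (begin
  toℚᵘ (ratio a (suc b) ℚ.* fromℕ (suc b))           ≈⟨ ℚₚ.toℚᵘ-homo-* (ratio a (suc b)) (fromℕ (suc b)) ⟩
  toℚᵘ (ratio a (suc b)) ℚᵘ.* toℚᵘ (fromℕ (suc b))   ≈⟨ ℚᵘₚ.*-cong (ratio-toℚᵘ a b) (fromℕ-toℚᵘ (suc b)) ⟩
  mkℚᵘ (ℤ.+ a) b ℚᵘ.* mkℚᵘ (ℤ.+ suc b) 0             ≈⟨ *≡* (identity (ℤ.+ a) (ℤ.+ suc b)) ⟩
  mkℚᵘ (ℤ.+ a) 0                                     ≈⟨ fromℕ-toℚᵘ a ⟨
  toℚᵘ (fromℕ a)                                     ∎)
  where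
  open ℚᵘₚ.≃-Reasoning
  identity : ∀ a b → a ℤ.* b ℤ.* ℤ.+ 1 ≡ a ℤ.* (b ℤ.* ℤ.+ 1)
  identity = ℤ-Ring.solve-∀

ratio-complement : ∀ a b c → a + b ≡ c → .{{_ : NonZero c}} → ratio a c ℚ.+ ratio b c ≡ 1ℚ
ratio-complement a b (suc c) a+b≡c = ℚₚ.toℚᵘ-injective (begin
  toℚᵘ (ratio a (suc c) ℚ.+ ratio b (suc c))              ≈⟨ ℚₚ.toℚᵘ-homo-+ (ratio a (suc c)) (ratio b (suc c)) ⟩
  toℚᵘ (ratio a (suc c)) ℚᵘ.+ toℚᵘ (ratio b (suc c))      ≈⟨ ℚᵘₚ.+-cong (ratio-toℚᵘ a c) (ratio-toℚᵘ b c) ⟩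
  mkℚᵘ (ℤ.+ a) c ℚᵘ.+ mkℚᵘ (ℤ.+ b) c                      ≈⟨ *≡* numerators ⟩
  ℚᵘ.1ℚᵘ                                                  ∎)
  where
  open ℚᵘₚ.≃-Reasoning
  factor : ∀ a b c → (a ℤ.* c ℤ.+ b ℤ.* c) ℤ.* ℤ.+ 1 ≡ ℤ.+ 1 ℤ.* ((a ℤ.+ b) ℤ.* c)
  factor = ℤ-Ring.solve-∀

  numerators : (ℤ.+ a ℤ.* ℤ.+ suc c ℤ.+ ℤ.+ b ℤ.* ℤ.+ suc c) ℤ.* ℤ.+ 1 ≡ ℤ.+ 1 ℤ.* (ℤ.+ suc c ℤ.* ℤ.+ suc c)
  numerators = trans (factor (ℤ.+ a) (ℤ.+ b) (ℤ.+ suc c)) (cong (λ m → ℤ.+ 1 ℤ.* (ℤ.+ m ℤ.* ℤ.+ suc c)) a+b≡c)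

0≤ratio-*-fromℕ : ∀ a b p → 0ℚ ℚ.≤ ratio a b ℚ.* fromℕ p
0≤ratio-*-fromℕ a b p =
  ℚₚ.nonNegative⁻¹ _ {{ℚₚ.nonNeg*nonNeg⇒nonNeg (ratio a b) {{ratio-nonNeg a b}} (fromℕ p) {{fromℕ-nonNeg p}}}}

ratio-*-fromℕ≤ : ∀ a b {p} → p ≤ b → .{{_ : NonZero b}} → ratio a b ℚ.* fromℕ p ℚ.≤ fromℕ a
ratio-*-fromℕ≤ a b p≤b = ℚₚ.≤-trans
  (ℚₚ.*-monoˡ-≤-nonNeg (ratio a b) {{ratio-nonNeg a b}} (fromℕ-mono-≤ p≤b)) (ℚₚ.≤-reflexive (ratio-* a b))

-- The denominator of `δ` works, as its numerator is at least 1.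
archimedean : ∀ δ → 0ℚ ℚ.< δ → ∃[ F ] 1ℚ ℚ.≤ fromℕ F ℚ.* δ
archimedean δ@(mkℚ +[1+ p ] d _) _ = suc d , (begin
  1ℚ                                        ≤⟨ fromℕ-mono-≤ {1} {suc p} (s≤s z≤n) ⟩
  fromℕ (suc p)                             ≡⟨ ratio-* (suc p) (suc d) ⟨
  ratio (suc p) (suc d) ℚ.* fromℕ (suc d)   ≡⟨ cong (ℚ._* fromℕ (suc d)) (ℚₚ.↥p/↧p≡p δ) ⟩
  δ ℚ.* fromℕ (suc d)                       ≡⟨ ℚₚ.*-comm δ (fromℕ (suc d)) ⟩
  fromℕ (suc d) ℚ.* δ                       ∎)
  where open ℚₚ.≤-Reasoning
archimedean (mkℚ (ℤ.+ 0) _ _) (ℚ.*<* (ℤ.+<+ ()))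
archimedean (mkℚ ℤ.-[1+ _ ] _ _) (ℚ.*<* ())

-- Replaces a positive real by a natural number. If `δ` is eventually below `x` and `1 ≤ F δ`, then
-- eventually `c ≤ B ≤ F B δ ≤ S δ ≤ S x`.
0<ℝ⇒bound : ∀ x → 0ℝ <ℝ x → ∃[ F ] (∀ B S c → F * B ≤ S → c ℚ.≤ fromℕ B → fromℚ c ≤ℝ fromℕ S · x)
0<ℝ⇒bound x (δ , 0<δ , N , eventually) with archimedean δ 0<δ
... | F , 1≤Fδ = F , λ B S c FB≤S c≤B δ′ 0<δ′ → N , λ n N≤n → begin
  c                              ≤⟨ c≤B ⟩
  fromℕ B                        ≡⟨ ℚₚ.*-identityʳ (fromℕ B) ⟨
  fromℕ B ℚ.* 1ℚ                 ≤⟨ ℚₚ.*-monoˡ-≤-nonNeg (fromℕ B) {{fromℕ-nonNeg B}} 1≤Fδ ⟩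
  fromℕ B ℚ.* (fromℕ F ℚ.* δ)    ≡⟨ ℚₚ.*-assoc (fromℕ B) (fromℕ F) δ ⟨
  fromℕ B ℚ.* fromℕ F ℚ.* δ      ≡⟨ cong (ℚ._* δ) (trans (ℚₚ.*-comm (fromℕ B) (fromℕ F)) (sym (fromℕ-* F B))) ⟩
  fromℕ (F * B) ℚ.* δ            ≤⟨ ℚₚ.*-monoʳ-≤-nonNeg δ {{ℚ.nonNegative (ℚₚ.<⇒≤ 0<δ)}} (fromℕ-mono-≤ FB≤S) ⟩
  fromℕ S ℚ.* δ                  ≤⟨ ℚₚ.*-monoˡ-≤-nonNeg (fromℕ S) {{fromℕ-nonNeg S}}
                                      (subst (ℚ._≤ seq x n) (ℚₚ.+-identityˡ δ) (eventually n N≤n)) ⟩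
  fromℕ S ℚ.* seq x n            ≡⟨ ℚₚ.+-identityʳ _ ⟨
  fromℕ S ℚ.* seq x n ℚ.+ 0ℚ     ≤⟨ ℚₚ.+-monoʳ-≤ (fromℕ S ℚ.* seq x n) (ℚₚ.<⇒≤ 0<δ′) ⟩
  fromℕ S ℚ.* seq x n ℚ.+ δ′     ∎
  where open ℚₚ.≤-Reasoning

p-q≤p : ∀ p q → 0ℚ ℚ.≤ q → p ℚ.- q ℚ.≤ p
p-q≤p p q 0≤q = subst (p ℚ.- q ℚ.≤_) (ℚₚ.+-identityʳ p) (ℚₚ.+-monoʳ-≤ p (ℚₚ.neg-antimono-≤ 0≤q))

∣p-q∣≤ : ∀ {p q r} → 0ℚ ℚ.≤ p → p ℚ.≤ r → 0ℚ ℚ.≤ q → q ℚ.≤ r → ℚ.∣ p ℚ.- q ∣ ℚ.≤ r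
∣p-q∣≤ {p} {q} 0≤p p≤r 0≤q q≤r with ℚₚ.∣p∣≡p∨∣p∣≡-p (p ℚ.- q)
... | inj₁ eq rewrite eq = ℚₚ.≤-trans (p-q≤p p q 0≤q) p≤r
... | inj₂ eq rewrite eq | ℚₚ.neg-distrib-+ p (ℚ.- q) | ⁻¹-involutive q | ℚₚ.+-comm (ℚ.- p) q =
  ℚₚ.≤-trans (p-q≤p q p 0≤p) q≤r

-- Of p pairs among S, e are edges among E, and z are non-edges among Z.
module _ {e z p E Z S : ℕ} (e+z≡p : e + z ≡ p) (E+Z≡S : E + Z ≡ S) (e≤E : e ≤ E) (z≤Z : z ≤ Z)
         .{{_ : NonZero S}} where

  private
    d = ratio E S
    d̄ = ratio Z S

    p≤S : p ≤ S
    p≤S = subst₂ _≤_ e+z≡p E+Z≡S (+-mono-≤ e≤E z≤Z)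

  -- Both `e` and its expected value `d p` lie between 0 and `E`.
  discrepancy≤edges : ℚ.∣ fromℕ e ℚ.- d ℚ.* fromℕ p ∣ ℚ.≤ fromℕ E
  discrepancy≤edges =
    ∣p-q∣≤ (0≤fromℕ e) (fromℕ-mono-≤ e≤E) (0≤ratio-*-fromℕ E S p) (ratio-*-fromℕ≤ E S p≤S)

  -- The densities of edges and non-edges add up to 1, so passing to non-edges only changes the sign
  -- of the discrepancy.
  discrepancy≤nonedges : ℚ.∣ fromℕ e ℚ.- d ℚ.* fromℕ p ∣ ℚ.≤ fromℕ Z
  discrepancy≤nonedges = subst (λ a → ℚ.∣ a ∣ ℚ.≤ fromℕ Z) (sym opposite)
    (∣p-q∣≤ (0≤ratio-*-fromℕ Z S p) (ratio-*-fromℕ≤ Z S p≤S) (0≤fromℕ z) (fromℕ-mono-≤ z≤Z))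
    where
    -- With `d + d̄` in place of 1 this is an identity of commutative rings.
    regroup : ∀ d d̄ e z → (d ℚ.+ d̄) ℚ.* e ℚ.- d ℚ.* (e ℚ.+ z) ≡ d̄ ℚ.* (e ℚ.+ z) ℚ.- (d ℚ.+ d̄) ℚ.* z
    regroup = solve 4 (λ d d̄ e z → (d :+ d̄) :* e :- d :* (e :+ z) := d̄ :* (e :+ z) :- (d :+ d̄) :* z) refl
      where open +-*-Solver

    times-1 : ∀ m → fromℕ m ≡ (d ℚ.+ d̄) ℚ.* fromℕ m
    times-1 m = trans (sym (ℚₚ.*-identityˡ (fromℕ m)))
      (cong (ℚ._* fromℕ m) (sym (ratio-complement E Z S E+Z≡S)))

    p≡e+z : fromℕ p ≡ fromℕ e ℚ.+ fromℕ z
    p≡e+z = trans (cong fromℕ (sym e+z≡p)) (fromℕ-+ e z)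

    opposite : fromℕ e ℚ.- d ℚ.* fromℕ p ≡ d̄ ℚ.* fromℕ p ℚ.- fromℕ z
    opposite = begin
      fromℕ e ℚ.- d ℚ.* fromℕ p                               ≡⟨ cong₂ (λ a b → a ℚ.- d ℚ.* b) (times-1 e) p≡e+z ⟩
      (d ℚ.+ d̄) ℚ.* fromℕ e ℚ.- d ℚ.* (fromℕ e ℚ.+ fromℕ z)   ≡⟨ regroup d d̄ (fromℕ e) (fromℕ z) ⟩
      d̄ ℚ.* (fromℕ e ℚ.+ fromℕ z) ℚ.- (d ℚ.+ d̄) ℚ.* fromℕ z   ≡⟨ cong₂ (λ a b → d̄ ℚ.* b ℚ.- a) (times-1 z) p≡e+z ⟨
      d̄ ℚ.* fromℕ p ℚ.- fromℕ z                               ∎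
      where open ≡-Reasoning

-- From homogeneity to discrepancy

module _ {n : ℕ} (G : Graph n) where

  Nonempty⇒0<∣∣ : ∀ {A : Subset n} → Nonempty A → 0 < ∣ A ∣
  Nonempty⇒0<∣∣ (x , x∈A) = m<n⇒0<n (x∈p⇒∣p-x∣<∣p∣ x∈A)

  e+nonedges : ∀ X Y → e G X Y + count (complement (adj G)) X Y ≡ ∣ X ∣ * ∣ Y ∣
  e+nonedges X Y = trans (cong (_+ count (complement (adj G)) X Y) (e≡count G X Y)) (count-complement (adj G) X Y)

  e-mono : ∀ {X X′ Y Y′} → X′ ⊆ X → Y′ ⊆ Y → e G X′ Y′ ≤ e G X Y
  e-mono {X} {X′} {Y} {Y′} X′⊆X Y′⊆Y =
    subst₂ _≤_ (sym (e≡count G X′ Y′)) (sym (e≡count G X Y)) (count-mono (adj G) {X′} {X} {Y′} {Y} X′⊆X Y′⊆Y)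

  -- Whichever of edges and non-edges are few, their number in `X × Y` bounds the discrepancy of all
  -- subsets at once. Nonemptiness keeps the denominator of the density away from 0.
  Homogeneous⇒Disc₂ : ∀ F x X Y → (∀ B S c → F * B ≤ S → c ℚ.≤ fromℕ B → fromℚ c ≤ℝ fromℕ S · x) →
                      Nonempty X → Nonempty Y → Homogeneous G F X Y → Disc₂ G x X Y
  Homogeneous⇒Disc₂ F x X Y bound X≠∅ Y≠∅ homogeneous X′ Y′ X′⊆X Y′⊆Y = close homogeneous
    where
    instance
      XY≢0 : NonZero (∣ X ∣ * ∣ Y ∣)
      XY≢0 = m*n≢0 ∣ X ∣ ∣ Y ∣ {{>-nonZero (Nonempty⇒0<∣∣ X≠∅)}} {{>-nonZero (Nonempty⇒0<∣∣ Y≠∅)}}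

    nonedges : Subset n → Subset n → ℕ
    nonedges = count (complement (adj G))

    nonedges-mono : nonedges X′ Y′ ≤ nonedges X Y
    nonedges-mono = count-mono (complement (adj G)) {X′} {X} {Y′} {Y} X′⊆X Y′⊆Y

    close : Homogeneous G F X Y → _
    close (inj₁ few-edges) = bound (e G X Y) (∣ X ∣ * ∣ Y ∣) _
      (subst (λ c → F * c ≤ ∣ X ∣ * ∣ Y ∣) (sym (e≡count G X Y)) few-edges)
      (discrepancy≤edges (e+nonedges X′ Y′) (e+nonedges X Y) (e-mono X′⊆X Y′⊆Y) nonedges-mono)
    close (inj₂ few-nonedges) = bound (nonedges X Y) (∣ X ∣ * ∣ Y ∣) _ few-nonedges
      (discrepancy≤nonedges (e+nonedges X′ Y′) (e+nonedges X Y) (e-mono X′⊆X Y′⊆Y) nonedges-mono)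

theorem5p7 : (k : ℕ) → 1 ≤ k →
    (ε : ℝ) → 0ℝ <ℝ ε →
    (f : ℕ → ℝ) →
    (∀ m → 0ℝ <ℝ f m) → (∀ m → f m ≤ℝ 1ℝ) →
    (∀ i j → i ≤ j → f j ≤ℝ f i) →
    ∃ λ (M : ℕ) →
    ∀ (n : ℕ) (G : Graph n) → Stable G k →
    ∃ λ (m : ℕ) → m ≤ M ×
    ∃ λ (W : Fin (suc m) → Subset n) →
    IsPartition W ×
    fromℚ (fromℕ ∣ W zero ∣) ≤ℝ fromℕ n · ε ×
    (∀ (i j : Fin m) →
    Disc₂ G (f m) (W (suc i)) (W (suc j)) ×
    ∣ W (suc i) ∣ ≡ ∣ W (suc j) ∣)
theorem5p7 k _ ε 0<ε f 0<f _ _ = proj₁ partition , λ n G stable →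
  let m , m≤M , W , isPartition , exceptional , homogeneous = proj₂ partition G stable
      nonempty = IsPartition.nonempty isPartition
  in m , m≤M , W , isPartition ,
     proj₂ ε-bound ∣ W zero ∣ n (fromℕ ∣ W zero ∣) exceptional ℚₚ.≤-refl ,
     λ i j → Homogeneous⇒Disc₂ G (proj₁ (f-bound m)) (f m) (W (suc i)) (W (suc j)) (proj₂ (f-bound m))
               (nonempty i) (nonempty j) (proj₁ (homogeneous i j)) ,
             proj₂ (homogeneous i j)
  where
  -- The reals `ε` and `f m` enter the combinatorial part as natural numbers whose reciprocals do
  -- not exceed them.
  ε-bound = 0<ℝ⇒bound ε 0<ε

  f-bound : ∀ m → _
  f-bound m = 0<ℝ⇒bound (f m) (0<f m)

  partition = homogeneous-partition k (proj₁ ε-bound) (proj₁ ∘ f-bound)
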